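{- Let $C>1$ be a constant. There is a (sufficiently small) constant $c>0$ such that the following holds: if a randomized algorithm solves the $\ell_\infty$ regression problem up to a relative error of $c\sqrt d$, i.e., given any $A\in\mathbb R^{n\times d}$ and query access to any $b\in\mathbb R^n$ it outputs $\tilde x$ with $$\|A\tilde x-b\|_\infty\le c\sqrt d\,\min_{x\in\mathbb R^d}\|Ax-b\|_\infty$$ with probability at least $0.99$, and it queries $m$ entries of $b$ in expectation, then $m=\Omega(d^C)$.
   Context: Active regression: the design matrix $A$ is fully known to the algorithm, while each entry of $b$ read counts as one query. The lower bound is worst case over instances with $d$ columns ($n$ may depend on $d$ and $C$); $m$ is the worst-case expected number of queries. The constant in $\Omega(\cdot)$ may depend on $C$. -}

module Defs where

open import Algebra.Bundles using (CommutativeRing)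
open import Axiom.ExcludedMiddle using (ExcludedMiddle)
open import Data.Empty using (⊥-elim)
open import Data.Fin.Base using (Fin; toℕ)
open import Data.Nat.Base as ℕ using (ℕ; zero; suc; NonZero)
import Data.Nat.Properties as ℕ
open import Data.Product.Base using (∃; ∃₂; _×_; _,_; proj₁; proj₂)
open import Data.Sum.Base using (inj₁; inj₂)
open import Data.Vec.Functional as Vector using (Vector)
open import Level using (Level; 0ℓ; _⊔_) renaming (suc to lsuc)
open import Relation.Binary.Bundles using (TotalOrder)
open import Relation.Binary.Core using (Rel)
open import Relation.Binary.PropositionalEquality.Core as ≡ using (_≡_)
open import Relation.Binary.Structures using (IsTotalOrder)
open import Relation.Nullary.Decidable.Core using (yes; no)
open import Relation.Nullary.Negation.Core using (¬_)
open import Relation.Unary using (Pred; _∈_; U; ∁; ⋃; _≐_)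

private variable
  a ℓ ℓ₂ : Level

IsLUB : {A : Set a} → Rel A ℓ₂ → Pred A ℓ → A → Set (a ⊔ ℓ ⊔ ℓ₂)
IsLUB _≤_ S s = (∀ x → x ∈ S → x ≤ s) × (∀ u → (∀ x → x ∈ S → x ≤ u) → s ≤ u)

-- The axioms of the real numbers.  Classically they determine ℝ up to
-- isomorphism, so a statement about every such field is a statement about ℝ.
record CompleteOrderedField : Set₁ where
  infix 4 _≤_
  field
    commutativeRing : CommutativeRing 0ℓ 0ℓ
  open CommutativeRing commutativeRing public
  field
    _≤_          : Rel Carrier 0ℓ
    isTotalOrder : IsTotalOrder _≈_ _≤_
    +-monoʳ-≤    : ∀ z {x y} → x ≤ y → z + x ≤ z + y
    *-nonNeg     : ∀ {x y} → 0# ≤ x → 0# ≤ y → 0# ≤ x * y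
    0≉1          : ¬ 0# ≈ 1#
    inverse      : ∀ x → ¬ x ≈ 0# → ∃ λ y → x * y ≈ 1#
    supremum     : (S : Pred Carrier 0ℓ) → ∃ S → (∃ λ u → ∀ x → x ∈ S → x ≤ u) →
                   ∃ λ s → IsLUB _≤_ S s

  totalOrder : TotalOrder 0ℓ 0ℓ 0ℓ
  totalOrder = record { isTotalOrder = isTotalOrder }

module RealAnalysis (em : ExcludedMiddle 0ℓ) (ℝ : CompleteOrderedField) where

  open CompleteOrderedField ℝ public
    using (Carrier; _≈_; _≤_; _+_; _*_; -_; _-_; 0#; 1#)
  open CompleteOrderedField ℝ
    hiding (Carrier; _≈_; _≤_; _+_; _*_; -_; _-_; 0#; 1#; zero)
  open import Relation.Binary.Construct.NonStrictToStrict _≈_ _≤_ public using (_<_)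
  open import Algebra.Construct.NaturalChoice.Max totalOrder public
    using () renaming (_⊔_ to max)
  open import Algebra.Properties.Semiring.Sum semiring public using (sum; sum-syntax)
  open import Algebra.Properties.Semiring.Exp semiring public using (_^_)
  open import Algebra.Properties.Semiring.Mult semiring public
    using () renaming (_×_ to _·_)
  open IsTotalOrder isTotalOrder using (total; antisym)
    renaming (refl to ≤-refl; trans to ≤-trans; reflexive to ≤-reflexive)
  open import Algebra.Properties.Ring ring
    using (-‿distribˡ-*; -‿distribʳ-*; -‿involutive)
  open import Algebra.Properties.AbelianGroup +-abelianGroup using (⁻¹-anti-homo‿-)
  open import Algebra.Properties.Semiring.Exp semiring using (^-assocʳ)
  open import Algebra.Properties.Semiring.Mult semiring using (×1-homo-*)
  open import Relation.Binary.Reasoning.Setoid setoid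

  fromℕ : ℕ → Carrier
  fromℕ n = n · 1#

  ∣_∣ : Carrier → Carrier
  ∣ x ∣ = max x (- x)

  ≤-resp : ∀ {x x′ y y′} → x ≈ x′ → y ≈ y′ → x ≤ y → x′ ≤ y′
  ≤-resp p q r = ≤-trans (≤-reflexive (sym p)) (≤-trans r (≤-reflexive q))

  x+[y-x]≈y : ∀ x y → x + (y - x) ≈ y
  x+[y-x]≈y x y = begin
    x + (y - x)   ≈⟨ +-congˡ (+-comm y (- x)) ⟩
    x + (- x + y) ≈⟨ sym (+-assoc x (- x) y) ⟩
    (x - x) + y   ≈⟨ +-congʳ (-‿inverseʳ x) ⟩
    0# + y        ≈⟨ +-identityˡ y ⟩
    y             ∎

  x≤y⇒0≤y-x : ∀ {x y} → x ≤ y → 0# ≤ y - x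
  x≤y⇒0≤y-x {x} {y} x≤y =
    ≤-resp (-‿inverseˡ x) (+-comm (- x) y) (+-monoʳ-≤ (- x) x≤y)

  0≤y-x⇒x≤y : ∀ {x y} → 0# ≤ y - x → x ≤ y
  0≤y-x⇒x≤y {x} {y} h = ≤-resp (+-identityʳ x) (x+[y-x]≈y x y) (+-monoʳ-≤ x h)

  0≤1 : 0# ≤ 1#
  0≤1 with total 0# 1#
  ... | inj₁ 0≤1 = 0≤1
  ... | inj₂ 1≤0 = ≤-resp refl [-1][-1]≈1 (*-nonNeg 0≤-1 0≤-1)
    where
    0≤-1 : 0# ≤ - 1#
    0≤-1 = ≤-resp refl (+-identityˡ (- 1#)) (x≤y⇒0≤y-x 1≤0)
    [-1][-1]≈1 : - 1# * - 1# ≈ 1#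
    [-1][-1]≈1 = begin
      - 1# * - 1#     ≈⟨ sym (-‿distribˡ-* 1# (- 1#)) ⟩
      - (1# * - 1#)   ≈⟨ -‿cong (*-identityˡ (- 1#)) ⟩
      - (- 1#)        ≈⟨ -‿involutive 1# ⟩
      1#              ∎

  1≰0 : ¬ 1# ≤ 0#
  1≰0 1≤0 = 0≉1 (antisym 0≤1 1≤0)

  x≤1+x : ∀ x → x ≤ 1# + x
  x≤1+x x = ≤-resp (+-identityʳ x) (+-comm x 1#) (+-monoʳ-≤ x 0≤1)

  1+x≰x : ∀ x → ¬ 1# + x ≤ x
  1+x≰x x h = 1≰0 (≤-resp
    (trans (+-congˡ (+-comm 1# x)) (trans (sym (+-assoc (- x) x 1#))
      (trans (+-congʳ (-‿inverseˡ x)) (+-identityˡ 1#))))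
    (-‿inverseˡ x) (+-monoʳ-≤ (- x) h))

  *-monoˡ-≤ : ∀ {z x y} → 0# ≤ z → x ≤ y → z * x ≤ z * y
  *-monoˡ-≤ {z} {x} {y} 0≤z x≤y = 0≤y-x⇒x≤y (≤-resp refl
    (trans (distribˡ z y (- x)) (+-congˡ (sym (-‿distribʳ-* z x))))
    (*-nonNeg 0≤z (x≤y⇒0≤y-x x≤y)))

  *-monoʳ-≤ : ∀ {z x y} → 0# ≤ z → x ≤ y → x * z ≤ y * z
  *-monoʳ-≤ {z} {x} {y} 0≤z x≤y =
    ≤-resp (*-comm z x) (*-comm z y) (*-monoˡ-≤ 0≤z x≤y)

  0≤fromℕ : ∀ n → 0# ≤ fromℕ n
  0≤fromℕ zero    = ≤-refl
  0≤fromℕ (suc n) = ≤-trans (0≤fromℕ n) (x≤1+x _)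

  fromℕ-mono : ∀ {m n} → m ℕ.≤ n → fromℕ m ≤ fromℕ n
  fromℕ-mono {n = n} ℕ.z≤n = 0≤fromℕ n
  fromℕ-mono (ℕ.s≤s m≤n)   = +-monoʳ-≤ 1# (fromℕ-mono m≤n)

  fromℕ-cancel : ∀ {m n} → fromℕ m ≤ fromℕ n → m ℕ.≤ n
  fromℕ-cancel {m} {n} h with m ℕ.≤? n
  ... | yes m≤n = m≤n
  ... | no  m≰n = ⊥-elim (1+x≰x _ (≤-trans (fromℕ-mono (ℕ.≰⇒> m≰n)) h))

  1≤fromℕ : ∀ d .{{_ : NonZero d}} → 1# ≤ fromℕ d
  1≤fromℕ (suc d) = ≤-resp (+-identityʳ 1#) refl (+-monoʳ-≤ 1# (0≤fromℕ d))

  archimedean : ∀ x → ∃ λ k → x ≤ fromℕ k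
  archimedean x with em {P = ∃ λ k → x ≤ fromℕ k}
  ... | yes p = p
  ... | no ¬p = ⊥-elim (1+x≰x (s - 1#) (≤-trans (≤-reflexive (x+[y-x]≈y 1# s)) s≤s-1))
    where
    below : ∀ k → fromℕ k ≤ x
    below k with total x (fromℕ k)
    ... | inj₁ x≤k = ⊥-elim (¬p (k , x≤k))
    ... | inj₂ k≤x = k≤x
    sup = supremum (λ y → ∃ λ k → y ≈ fromℕ k) (0# , 0 , refl)
            (x , λ { y (k , y≈k) → ≤-trans (≤-reflexive y≈k) (below k) })
    s = proj₁ sup
    s≤s-1 : s ≤ s - 1#
    s≤s-1 = proj₂ (proj₂ sup) (s - 1#) λ { y (k , y≈k) →
      ≤-resp (trans (trans (sym (+-assoc (- 1#) 1# _))
                (trans (+-congʳ (-‿inverseˡ 1#)) (+-identityˡ _))) (sym y≈k))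
             (+-comm (- 1#) s)
             (+-monoʳ-≤ (- 1#) (proj₁ (proj₂ sup) (fromℕ (suc k)) (suc k , refl))) }

  1≤x^n : ∀ {x} → 1# ≤ x → ∀ n → 1# ≤ x ^ n
  1≤x^n 1≤x zero    = ≤-refl
  1≤x^n {x} 1≤x (suc n) = ≤-trans 1≤x (≤-resp (*-identityʳ x) refl
    (*-monoˡ-≤ (≤-trans 0≤1 1≤x) (1≤x^n 1≤x n)))

  ^-monoˡ : ∀ {x y} → 0# ≤ x → x ≤ y → ∀ n → x ^ n ≤ y ^ n
  ^-monoˡ 0≤x x≤y zero = ≤-refl
  ^-monoˡ {x} {y} 0≤x x≤y (suc n) =
    ≤-trans (*-monoˡ-≤ 0≤x (^-monoˡ 0≤x x≤y n)) (*-monoʳ-≤ (0≤^ n) x≤y)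
    where
    0≤^ : ∀ n → 0# ≤ y ^ n
    0≤^ zero    = 0≤1
    0≤^ (suc n) = *-nonNeg (≤-trans 0≤x x≤y) (0≤^ n)

  ^-monoʳ : ∀ {x} → 1# ≤ x → ∀ {m n} → m ℕ.≤ n → x ^ m ≤ x ^ n
  ^-monoʳ 1≤x {n = n} ℕ.z≤n = 1≤x^n 1≤x n
  ^-monoʳ 1≤x (ℕ.s≤s m≤n)   = *-monoˡ-≤ (≤-trans 0≤1 1≤x) (^-monoʳ 1≤x m≤n)

  ^-cancel : ∀ {y u} → 1# ≤ u → ∀ n → y ^ suc n ≤ u ^ suc n → y ≤ u
  ^-cancel {y} {u} 1≤u n h with total y u
  ... | inj₁ y≤u = y≤u
  ... | inj₂ u≤y = 0≤y-x⇒x≤y (≤-resp refl neg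
          (x≤y⇒0≤y-x (≤-trans y-u≤ ≤0)))
    where
    v = u ^ n
    0≤u = ≤-trans 0≤1 1≤u
    0≤y = ≤-trans 0≤u u≤y
    yv≤uv : y * v ≤ u * v
    yv≤uv = ≤-trans (*-monoˡ-≤ 0≤y (^-monoˡ 0≤u u≤y n)) h
    y-u≤ : y - u ≤ (y - u) * v
    y-u≤ = ≤-resp (*-identityʳ _) refl (*-monoˡ-≤ (x≤y⇒0≤y-x u≤y) (1≤x^n 1≤u n))
    ≤0 : (y - u) * v ≤ 0#
    ≤0 = ≤-resp
      (trans (+-comm _ _) (trans (+-congˡ (-‿distribˡ-* u v)) (sym (distribʳ v y (- u)))))
      (-‿inverseˡ (u * v)) (+-monoʳ-≤ (- (u * v)) yv≤uv)
    neg : 0# - (y - u) ≈ u - y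
    neg = trans (+-identityˡ _) (⁻¹-anti-homo‿- y u)

  1<x⇒0≤x : ∀ {x} → 1# < x → 0# ≤ x
  1<x⇒0≤x (1≤x , _) = ≤-trans 0≤1 1≤x

  private
    √-supremum : ∀ d → ∃ (IsLUB _≤_ (λ y → y * y ≤ fromℕ d))
    √-supremum d = supremum (λ y → y * y ≤ fromℕ d)
      (0# , ≤-resp (sym (zeroˡ 0#)) refl (0≤fromℕ d))
      (1# + fromℕ d , bound)
      where
      bound : ∀ y → y * y ≤ fromℕ d → y ≤ 1# + fromℕ d
      bound y y²≤d with total y 1#
      ... | inj₁ y≤1 = ≤-trans y≤1 (≤-resp (+-identityʳ 1#) refl (+-monoʳ-≤ 1# (0≤fromℕ d)))
      ... | inj₂ 1≤y = ≤-trans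
              (≤-resp (*-identityʳ y) refl (*-monoˡ-≤ (≤-trans 0≤1 1≤y) 1≤y))
              (≤-trans y²≤d (x≤1+x _))

  √ : ℕ → Carrier
  √ d = proj₁ (√-supremum d)

  √-isLUB : ∀ d → IsLUB _≤_ (λ y → y * y ≤ fromℕ d) (√ d)
  √-isLUB d = proj₂ (√-supremum d)

  -- d ^ C for real C ≥ 0 and base d ≥ 1 is the supremum of the rational powers
  -- d ^ (p / suc q) with p / suc q ≤ C.  The condition y ^ suc q ≤ d ^ p admits every
  -- y ≥ 0 up to such a power; negative members do not affect the supremum.
  BelowPower : ℕ → Carrier → Pred Carrier 0ℓ
  BelowPower d C y = ∃₂ λ p q → fromℕ p ≤ C * fromℕ (suc q) × y ^ suc q ≤ fromℕ d ^ p

  private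
    rpow-supremum : ∀ d .{{_ : NonZero d}} C → 0# ≤ C → ∃ (IsLUB _≤_ (BelowPower d C))
    rpow-supremum d C 0≤C = supremum (BelowPower d C)
      (1# , 0 , 0 , *-nonNeg 0≤C (0≤fromℕ 1) , ≤-reflexive (*-identityʳ 1#))
      (fromℕ d ^ k , bound)
      where
      k = proj₁ (archimedean C)
      bound : ∀ y → y ∈ BelowPower d C → y ≤ fromℕ d ^ k
      bound y (p , q , p≤Cq , y^q≤d^p) = ^-cancel (1≤x^n (1≤fromℕ d) k) q
        (≤-trans y^q≤d^p (≤-resp refl (sym (^-assocʳ (fromℕ d) k (suc q)))
          (^-monoʳ (1≤fromℕ d) (fromℕ-cancel {p} {k ℕ.* suc q}
            (≤-resp refl (sym (×1-homo-* k (suc q)))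
              (≤-trans p≤Cq (*-monoʳ-≤ (0≤fromℕ (suc q)) (proj₂ (archimedean C)))))))))

  rpow : (d : ℕ) .{{_ : NonZero d}} (C : Carrier) → 0# ≤ C → Carrier
  rpow d C 0≤C = proj₁ (rpow-supremum d C 0≤C)

  rpow-isLUB : ∀ d .{{_ : NonZero d}} C (0≤C : 0# ≤ C) →
               IsLUB _≤_ (BelowPower d C) (rpow d C 0≤C)
  rpow-isLUB d C 0≤C = proj₂ (rpow-supremum d C 0≤C)

  Matrix : ℕ → ℕ → Set
  Matrix n d = Fin n → Vector Carrier d

  infixl 7 _*ᵥ_
  _*ᵥ_ : ∀ {n d} → Matrix n d → Vector Carrier d → Vector Carrier n
  (A *ᵥ x) i = sum λ j → A i j * x j

  ‖_‖∞ : ∀ {n} → Vector Carrier n → Carrier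
  ‖ v ‖∞ = Vector.foldr (λ x m → max ∣ x ∣ m) 0# v

  residual : ∀ {n d} → Matrix n d → Vector Carrier n → Vector Carrier d → Carrier
  residual A b x = ‖ (λ i → (A *ᵥ x) i - b i) ‖∞

  IsMinimizer : ∀ {n d} → Matrix n d → Vector Carrier n → Vector Carrier d → Set
  IsMinimizer A b x = ∀ y → residual A b x ≤ residual A b y

  ApproxSolution : ∀ {n d} → Carrier → Matrix n d → Vector Carrier n →
                   Vector Carrier d → Set
  ApproxSolution κ A b x̃ =
    ∃ λ x⋆ → IsMinimizer A b x⋆ × residual A b x̃ ≤ κ * residual A b x⋆

  record ProbabilitySpace : Set₁ where
    field
      Ω            : Set
      Measurable   : Pred (Pred Ω 0ℓ) 0ℓ
      measurable-≐ : ∀ {E F} → E ≐ F → Measurable E → Measurable F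
      measurable-U : Measurable U
      measurable-∁ : ∀ {E} → Measurable E → Measurable (∁ E)
      measurable-⋃ : ∀ (E : ℕ → Pred Ω 0ℓ) → (∀ i → Measurable (E i)) → Measurable (⋃ ℕ E)
      -- Only the values on measurable events are meaningful.
      ℙ            : Pred Ω 0ℓ → Carrier
      ℙ-≐          : ∀ {E F} → Measurable E → E ≐ F → ℙ E ≈ ℙ F
      ℙ-nonNeg     : ∀ {E} → Measurable E → 0# ≤ ℙ E
      ℙ-U          : ℙ U ≈ 1#
      ℙ-⋃          : ∀ (E : ℕ → Pred Ω 0ℓ) → (∀ i → Measurable (E i)) →
                     (∀ {i j ω} → ω ∈ E i → ω ∈ E j → i ≡ j) →
                     IsLUB _≤_ (λ s → ∃ λ N → s ≈ ∑[ i < N ] ℙ (E (toℕ i))) (ℙ (⋃ ℕ E))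

    ProbabilityAtLeast-99% : Pred Ω 0ℓ → Set
    ProbabilityAtLeast-99% E = Measurable E × fromℕ 99 ≤ fromℕ 100 * ℙ E

    -- X is a random variable with (finite) mean μ = Σₖ k · ℙ (X = k); the series
    -- has nonnegative terms, so its sum is the supremum of its partial sums.
    HasMean : (Ω → ℕ) → Carrier → Set
    HasMean X μ =
      (∀ k → Measurable (λ ω → X ω ≡ k)) ×
      IsLUB _≤_
        (λ s → ∃ λ N → s ≈ ∑[ k < N ] (fromℕ (toℕ k) * ℙ (λ ω → X ω ≡ toℕ k))) μ

  -- An adaptive deterministic algorithm with query access to b ∈ ℝⁿ: each node
  -- may depend on all the answers received so far.
  data QueryAlgorithm (n d : ℕ) : Set where
    output : Vector Carrier d → QueryAlgorithm n d
    query  : Fin n → (Carrier → QueryAlgorithm n d) → QueryAlgorithm n d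

  result : ∀ {n d} → QueryAlgorithm n d → Vector Carrier n → Vector Carrier d
  result (output x)  b = x
  result (query i k) b = result (k (b i)) b

  queryCount : ∀ {n d} → QueryAlgorithm n d → Vector Carrier n → ℕ
  queryCount (output x)  b = 0
  queryCount (query i k) b = suc (queryCount (k (b i)) b)

  record RandomizedQueryAlgorithm (n d : ℕ) : Set₁ where
    field
      space  : ProbabilitySpace
      choose : ProbabilitySpace.Ω space → QueryAlgorithm n d
    open ProbabilitySpace space public

  -- A randomized algorithm for regression problems with d columns; the design
  -- matrix is fully known, so it is an ordinary argument.
  RegressionAlgorithm : ℕ → Set₁
  RegressionAlgorithm d = ∀ {n} → Matrix n d → RandomizedQueryAlgorithm n d

  SolvesUpTo : ∀ {d} → Carrier → RegressionAlgorithm d → Set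
  SolvesUpTo κ alg = ∀ {n} (A : Matrix n _) (b : Vector Carrier n) →
    let open RandomizedQueryAlgorithm (alg A) in
    ProbabilityAtLeast-99% (λ ω → ApproxSolution κ A b (result (choose ω) b))

  ExpectedQueries : ∀ {n d} → RegressionAlgorithm d → Matrix n d → Vector Carrier n →
                    Carrier → Set
  ExpectedQueries alg A b μ =
    let open RandomizedQueryAlgorithm (alg A) in
    HasMean (λ ω → queryCount (choose ω) b) μ

  -- m is the worst-case expected number of queries over n × d instances.
  WorstCaseQueries : ∀ {d} → RegressionAlgorithm d → ℕ → Carrier → Set
  WorstCaseQueries {d} alg n m =
    (∀ (A : Matrix n d) b → ∃ (ExpectedQueries alg A b)) ×
    IsLUB _≤_ (λ μ → ∃₂ λ (A : Matrix n d) b → ExpectedQueries alg A b μ) m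

{-# OPTIONS --safe #-}
module Submission where

-- The rows of the design matrix are the graphs, as 0/1 vectors indexed by 𝔽ₚ × 𝔽ₚ, of the
-- n = pᵏ polynomials of degree < k over a prime field with p ~ √d.  Each row has p ones and two
-- of them share fewer than k, so x = (row f) shows that the vector b = p e_f has regression value
-- at most k, while an x with A x = 0 has residual p > c √d k on it.  For b = 0 the algorithm must
-- output x with A x = 0, hence unless it reads the entry f it fails on p e_f.  So on b = 0 each of
-- the n ≳ d^C entries is read with probability at least 0.98.  A prime within a constant factor
-- of √d is provided by Chebyshev's argument.

open import Defs
open import Axiom.ExcludedMiddle using (ExcludedMiddle)
open import Data.Nat.Base as ℕ using (ℕ; NonZero)
open import Data.Product.Base using (∃; _×_)
open import Level using (0ℓ)

-- Three demands compete: about `d ^ C` rows, squared norm of order √d, and pairwise inner products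
-- bounded by a constant. Polynomial graphs meet them together. The number `k` of coefficients sets
-- the row count `p ^ k` and, through the root count, bounds the inner products; since `p` is of
-- order √d, `k` has to be about `2 C`. The gap between residuals `p` and `k` is then of order √d /
-- `k`, which is why `c` depends on `C`. Counting roots needs 𝔽ₚ to be a field, so `p` has to be
-- prime and cannot just be √d rounded down. A constant factor lost between `p` and √d only changes
-- `c` and `K`, so a coarse prime gap estimate suffices. The bound concerns an expected number of
-- queries, and a mean is given only as the supremum of its partial sums. The probabilistic part
-- therefore replaces integration by counting on the level sets of the query count, cut off at a
-- level that is exceeded with probability at most 0.01.

module PrimeNearSquareRoot where
  open import Data.Nat.Base
  open import Data.Nat.Combinatorics using
    (_C_; nC1≡n; nCk+nC[k+1]≡[n+1]C[k+1]; k>n⇒nCk≡0; nCk≡n!/k![n-k]!; k![n∸k]!∣n!)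
  open import Data.Nat.Divisibility
  open import Data.Nat.DivMod using (m/n*n≡m)
  open import Data.Nat.Primality
  open import Data.Nat.Properties
  open import Data.Nat.Tactic.RingSolver using (solve-∀)
  open import Data.Product.Base using (∃; _×_; _,_)
  open import Data.Sum.Base using (inj₁; inj₂)
  open import Function.Base using (_∘_; _$_)
  open import Relation.Binary.PropositionalEquality
  open import Relation.Nullary
  open import Relation.Nullary.Decidable using (_×-dec_)

  -- Binomial coefficients: absorption identities, size bounds, common multiples.

  pascal : ∀ n k → suc n C suc k ≡ n C k + n C suc k
  pascal n k = sym (nCk+nC[k+1]≡[n+1]C[k+1] n k)

  -- Absorption: both sides count the `(k+1)`-subsets of an `(n+1)`-set with one marked member.
  [1+k]*[1+n]C[1+k]≡[1+n]*nCk : ∀ n k → suc k * (suc n C suc k) ≡ suc n * (n C k)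
  [1+k]*[1+n]C[1+k]≡[1+n]*nCk n zero =
      trans (*-identityˡ _) (trans (nC1≡n (suc n)) (sym (*-identityʳ (suc n))))
  [1+k]*[1+n]C[1+k]≡[1+n]*nCk zero (suc k)
    rewrite k>n⇒nCk≡0 {1} {2 + k} (s≤s (s≤s z≤n)) | k>n⇒nCk≡0 {0} {suc k} (s≤s z≤n) = *-zeroʳ k
  [1+k]*[1+n]C[1+k]≡[1+n]*nCk (suc n) (suc k) = begin
    suc (suc k) * (suc (suc n) C suc (suc k))
      ≡⟨ cong (suc (suc k) *_) (pascal (suc n) (suc k)) ⟩
    suc (suc k) * (suc n C suc k + suc n C suc (suc k))
      ≡⟨ split k (suc n C suc k) (suc n C suc (suc k)) ⟩
    suc n C suc k + (suc k * (suc n C suc k) + suc (suc k) * (suc n C suc (suc k)))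
      ≡⟨ cong (suc n C suc k +_)
        (cong₂ _+_ ([1+k]*[1+n]C[1+k]≡[1+n]*nCk n k) ([1+k]*[1+n]C[1+k]≡[1+n]*nCk n (suc k))) ⟩
    suc n C suc k + (suc n * (n C k) + suc n * (n C suc k))
      ≡⟨ cong (suc n C suc k +_) (trans (sym (*-distribˡ-+ (suc n) (n C k) (n C suc k)))
           (cong (suc n *_) (sym (pascal n k)))) ⟩
    suc (suc n) * (suc n C suc k) ∎
    where
    open ≡-Reasoning
    split : ∀ k a b → suc (suc k) * (a + b) ≡ a + (suc k * a + suc (suc k) * b)
    split = solve-∀

  -- Both sides count `k`-subsets with one marked point outside. Writing `r` for `n - k` keeps
  -- truncated subtraction out of the algebra; adding the absorption identity to both sides turns
  -- the claim into Pascal's rule.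
  [1+r]*[1+k+r]Ck≡[1+k+r]*[k+r]Ck : ∀ k r → suc r * (suc (k + r) C k) ≡ suc (k + r) * ((k + r) C k)
  [1+r]*[1+k+r]Ck≡[1+k+r]*[k+r]Ck zero r = refl
  [1+r]*[1+k+r]Ck≡[1+k+r]*[k+r]Ck (suc k) r = +-cancelˡ-≡ (suc k * (suc n C suc k)) _ _ $ begin
    suc k * (suc n C suc k) + suc r * (suc n C suc k)
      ≡⟨ merge k r (suc n C suc k) ⟩
    suc n * (suc n C suc k)
      ≡⟨ cong (suc n *_) (pascal n k) ⟩
    suc n * (n C k + n C suc k)
      ≡⟨ *-distribˡ-+ (suc n) (n C k) (n C suc k) ⟩
    suc n * (n C k) + suc n * (n C suc k)
      ≡⟨ cong (_+ suc n * (n C suc k)) (sym ([1+k]*[1+n]C[1+k]≡[1+n]*nCk n k)) ⟩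
    suc k * (suc n C suc k) + suc n * (n C suc k) ∎
    where
    open ≡-Reasoning
    n = suc k + r
    merge : ∀ k r x → suc k * x + suc r * x ≡ suc (suc (k + r)) * x
    merge = solve-∀

  nCk>0 : ∀ {n k} → k ≤ n → 0 < n C k
  nCk>0 {n} {zero} z≤n = s≤s z≤n
  nCk>0 {suc n} {suc k} (s≤s k≤n) =
    subst (0 <_) (sym (pascal n k)) (≤-trans (nCk>0 k≤n) (m≤m+n _ _))

  nCk≤2^n : ∀ n k → n C k ≤ 2 ^ n
  nCk≤2^n n zero = m^n>0 2 n
  nCk≤2^n zero (suc k) = ≤-trans (≤-reflexive (k>n⇒nCk≡0 {0} {suc k} (s≤s z≤n))) z≤n
  nCk≤2^n (suc n) (suc k) = begin
    suc n C suc k     ≡⟨ pascal n k ⟩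
    n C k + n C suc k ≤⟨ +-mono-≤ (nCk≤2^n n k) (≤-trans (nCk≤2^n n (suc k)) (m≤m+n _ 0)) ⟩
    2 ^ suc n         ∎
    where open ≤-Reasoning

  -- The next central coefficient is the sum of two entries of row `2n + 1`, each at least the
  -- current one, so it at least doubles.
  2^n≤2nCn : ∀ n → 2 ^ n ≤ (n + n) C n
  2^n≤2nCn zero = ≤-refl
  2^n≤2nCn (suc n) = begin
    2 ^ n + (2 ^ n + 0)                              ≡⟨ cong (2 ^ n +_) (+-identityʳ _) ⟩
    2 ^ n + 2 ^ n
      ≤⟨ +-mono-≤ (≤-trans (2^n≤2nCn n) (left n)) (≤-trans (2^n≤2nCn n) right) ⟩
    suc (n + n) C n + suc (n + n) C suc n            ≡⟨ sym (pascal (suc (n + n)) n) ⟩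
    suc (suc (n + n)) C suc n
      ≡⟨ cong (λ m → suc m C suc n) (sym (+-suc n n)) ⟩
    (suc n + suc n) C suc n                          ∎
    where
    open ≤-Reasoning
    left : ∀ k → (n + n) C k ≤ suc (n + n) C k
    left zero    = ≤-refl
    left (suc k) = ≤-trans (m≤n+m _ _) (≤-reflexive (sym (pascal (n + n) k)))
    right : (n + n) C n ≤ suc (n + n) C suc n
    right = ≤-trans (m≤m+n _ _) (≤-reflexive (sym (pascal (n + n) n)))

  -- Leibniz's harmonic triangle: L(n, k) = 1 / ((n+1) nCk) satisfies
  -- L(n+1, k+1) = L(n, k) - L(n+1, k), so every entry is an integer combination of
  -- 1, 1/2, ..., 1/(n+1).
  [1+n]*nCk∣commonMultiple : ∀ {M} n k → k ≤ n → (∀ j → j ≤ n → suc j ∣ M) → suc n * (n C k) ∣ M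
  [1+n]*nCk∣commonMultiple {M} n zero _ multiple =
    subst (_∣ M) (sym (*-identityʳ (suc n))) (multiple n ≤-refl)
  [1+n]*nCk∣commonMultiple {M} (suc n) (suc k) (s≤s k≤n) multiple
    with [1+n]*nCk∣commonMultiple n k k≤n (λ j j≤n → multiple j (m≤n⇒m≤1+n j≤n))
       | [1+n]*nCk∣commonMultiple (suc n) k (m≤n⇒m≤1+n k≤n) multiple
  -- Here `u = M L(n, k)` and `v = M L(n+1, k)`, so the recurrence makes `u - v = M L(n+1, k+1)` the
  -- quotient. The equation `us` shows that the truncated subtraction is exact.
  ... | divides u M≡ue | divides v M≡vF = divides (u ∸ v) (sym (*-cancelˡ-≡ _ _ b (begin
    b * ((u ∸ v) * G)          ≡⟨ swap b (u ∸ v) G ⟩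
    (u ∸ v) * (b * G)          ≡⟨ cong ((u ∸ v) *_) bG ⟩
    (u ∸ v) * (s * e)          ≡⟨ sym (*-assoc (u ∸ v) s e) ⟩
    (u ∸ v) * s * e            ≡⟨ cong (_* e) (*-distribʳ-∸ s u v) ⟩
    (u * s ∸ v * s) * e        ≡⟨ cong (λ x → (x ∸ v * s) * e) us ⟩
    (v * s + b * u ∸ v * s) * e ≡⟨ cong (_* e) (m+n∸m≡n (v * s) (b * u)) ⟩
    b * u * e                  ≡⟨ *-assoc b u e ⟩
    b * (u * e)                ≡⟨ cong (b *_) (sym M≡ue) ⟩
    b * M                      ∎)))
    where
    open ≡-Reasoning
    r = n ∸ k
    a = suc r
    b = suc k
    s = suc (suc n)
    e = suc n * (n C k)
    F = s * (suc n C k)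
    G = s * (suc n C suc k)
    swap : ∀ x y z → x * (y * z) ≡ y * (x * z)
    swap = solve-∀
    k+r≡n = m+[n∸m]≡n k≤n
    aF : a * F ≡ s * e
    aF = trans (swap a s (suc n C k)) (cong (s *_)
      (subst (λ m → suc r * (suc m C k) ≡ suc m * (m C k)) k+r≡n
        ([1+r]*[1+k+r]Ck≡[1+k+r]*[k+r]Ck k r)))
    bG : b * G ≡ s * e
    bG = trans (swap b s (suc n C suc k)) (cong (s *_) ([1+k]*[1+n]C[1+k]≡[1+n]*nCk n k))
    a+b : s ≡ a + b
    a+b = cong suc (trans (cong suc (trans (sym k+r≡n) (+-comm k r))) (sym (+-suc r k)))
    instance
      e≢0 : NonZero e
      e≢0 = m*n≢0 (suc n) (n C k) {{_}} {{>-nonZero (nCk>0 k≤n)}}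
    au : a * u ≡ v * s
    au = *-cancelʳ-≡ (a * u) (v * s) e (begin
      a * u * e   ≡⟨ *-assoc a u e ⟩
      a * (u * e) ≡⟨ cong (a *_) (trans (sym M≡ue) M≡vF) ⟩
      a * (v * F) ≡⟨ swap a v F ⟩
      v * (a * F) ≡⟨ cong (v *_) aF ⟩
      v * (s * e) ≡⟨ sym (*-assoc v s e) ⟩
      v * s * e   ∎)
    us : u * s ≡ v * s + b * u
    us = trans (cong (u *_) a+b) (trans (*-distribˡ-+ u a b)
      (cong₂ _+_ (trans (*-comm u a) au) (*-comm u b)))

  -- Products of the primes in an interval.

  primeOrOne : ℕ → ℕ
  primeOrOne q with prime? q
  ... | yes _ = q
  ... | no  _ = 1

  -- The range is the half-open `(m, m + n]`, so that products over adjacent intervals multiply.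
  primeProduct : ℕ → ℕ → ℕ
  primeProduct m zero    = 1
  primeProduct m (suc n) = primeOrOne (m + suc n) * primeProduct m n

  primeProduct-+ : ∀ m a b → primeProduct m (b + a) ≡ primeProduct (m + a) b * primeProduct m a
  primeProduct-+ m a zero    = sym (*-identityˡ _)
  primeProduct-+ m a (suc b) = trans
    (cong₂ _*_ (cong primeOrOne
      (trans (+-suc m (b + a)) (trans
      (cong suc (trans (cong (m +_) (+-comm b a)) (sym (+-assoc m a b)))) (sym (+-suc (m + a) b)))))
      (primeProduct-+ m a b))
    (sym (*-assoc (primeOrOne (m + a + suc b)) _ _))

  prime∤1 : ∀ {q} → Prime q → ¬ q ∣ 1
  prime∤1 pq q∣1 with ∣1⇒≡1 q∣1
  ... | refl = ¬prime[1] pq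

  prime∣primeProduct⇒≤ : ∀ {q} m n → Prime q → q ∣ primeProduct m n → q ≤ m + n
  prime∣primeProduct⇒≤ m zero pq q∣1 = contradiction q∣1 (prime∤1 pq)
  prime∣primeProduct⇒≤ m (suc n) pq q∣ with prime? (m + suc n)
  ... | no _ = ≤-trans (prime∣primeProduct⇒≤ m n pq (subst (_ ∣_) (*-identityˡ _) q∣))
      (+-monoʳ-≤ m (n≤1+n n))
  ... | yes pm with euclidsLemma (m + suc n) (primeProduct m n) pq q∣
  ...   | inj₁ q∣m = ∣⇒≤ {{prime⇒nonZero pm}} q∣m
  ...   | inj₂ q∣P = ≤-trans (prime∣primeProduct⇒≤ m n pq q∣P) (+-monoʳ-≤ m (n≤1+n n))

  -- The topmost prime exceeds every prime factor of the remaining product, so Euclid's lemma places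
  -- it in the cofactor `t`.
  primeProduct-∣ : ∀ {X} m n → (∀ {q} → Prime q → m < q → q ≤ m + n → q ∣ X) → primeProduct m n ∣ X
  primeProduct-∣ {X} m zero q∣X = 1∣ X
  primeProduct-∣ {X} m (suc n) q∣X
    with primeProduct-∣ {X} m n (λ pq m<q q≤ → q∣X pq m<q (≤-trans q≤ (+-monoʳ-≤ m (n≤1+n n))))
       | prime? (m + suc n)
  ... | P∣X | no _ = subst (_∣ X) (sym (*-identityˡ _)) P∣X
  ... | divides t X≡tP | yes pq
    with euclidsLemma t (primeProduct m n) pq
           (subst (m + suc n ∣_) X≡tP (q∣X pq (m<m+n m (s≤s z≤n)) ≤-refl))
  ...   | inj₁ q∣t = subst (_ ∣_) (sym X≡tP) (*-monoˡ-∣ (primeProduct m n) q∣t)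
  ...   | inj₂ q∣P = contradiction (prime∣primeProduct⇒≤ m n pq q∣P)
      (<⇒≱ (≤-reflexive (sym (+-suc m n))))

  primeProduct≢0 : ∀ m n → NonZero (primeProduct m n)
  primeProduct≢0 m zero = _
  primeProduct≢0 m (suc n) with prime? (m + suc n)
  ... | yes pq = m*n≢0 _ _ {{prime⇒nonZero pq}} {{primeProduct≢0 m n}}
  ... | no _   = m*n≢0 1 _ {{_}} {{primeProduct≢0 m n}}

  prime∣primeProduct : ∀ {q} n → Prime q → q ≤ n → q ∣ primeProduct 0 n
  prime∣primeProduct {q} zero pq z≤n = contradiction pq ¬prime[0]
  prime∣primeProduct {q} (suc n) pq q≤ with m≤n⇒m<n∨m≡n q≤
  ... | inj₁ (s≤s q≤n) = ∣n⇒∣m*n (primeOrOne (suc n)) (prime∣primeProduct n pq q≤n)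
  ... | inj₂ refl with prime? (suc n)
  ...   | yes _  = m∣m*n (primeProduct 0 n)
  ...   | no  ¬p = contradiction pq ¬p

  n∣n! : ∀ n .{{_ : NonZero n}} → n ∣ n !
  n∣n! (suc n) = m∣m*n (n !)

  m∣n! : ∀ {m n} .{{_ : NonZero m}} → m ≤ n → m ∣ n !
  m∣n! {m} m≤n = ∣-trans (n∣n! m) (m≤n⇒m!∣n! m≤n)

  prime∣n!⇒≤ : ∀ {q} n → Prime q → q ∣ n ! → q ≤ n
  prime∣n!⇒≤ zero pq q∣1 = contradiction q∣1 (prime∤1 pq)
  prime∣n!⇒≤ (suc n) pq q∣ with euclidsLemma (suc n) (n !) pq q∣
  ... | inj₁ q∣1+n = ∣⇒≤ q∣1+n
  ... | inj₂ q∣n!  = m≤n⇒m≤1+n (prime∣n!⇒≤ n pq q∣n!)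

  -- Such a `q` divides `(2n)!`, which is the binomial coefficient times `n! n!`, but exceeds `n`
  -- and so does not divide `n!`.
  prime∣2nCn : ∀ {q} n → Prime q → n < q → q ≤ n + n → q ∣ (n + n) C n
  prime∣2nCn {q} n pq n<q q≤2n
    with euclidsLemma ((n + n) C n) (n ! * (n + n ∸ n) !) pq
           (subst (q ∣_) (sym factorial) (m∣n! {{prime⇒nonZero pq}} q≤2n))
    where
    instance _ = n !* (n + n ∸ n) !≢0
    n≤2n = m≤m+n n n
    factorial : ((n + n) C n) * (n ! * (n + n ∸ n) !) ≡ (n + n) !
    factorial = trans (cong (_* (n ! * (n + n ∸ n) !)) (nCk≡n!/k![n-k]! n≤2n))
        (m/n*n≡m (k![n∸k]!∣n! n≤2n))
  ... | inj₁ q∣C = q∣C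
  ... | inj₂ q∣n!n! with euclidsLemma (n !) ((n + n ∸ n) !) pq q∣n!n!
  ...   | inj₁ q∣n! = contradiction (prime∣n!⇒≤ n pq q∣n!) (<⇒≱ n<q)
  ...   | inj₂ q∣n! = contradiction
      (prime∣n!⇒≤ n pq (subst (λ m → q ∣ m !) (m+n∸n≡m n n) q∣n!)) (<⇒≱ n<q)

  -- Chebyshev's doubling: the primes in `(n, 2n]` divide a binomial coefficient of size at most
  -- `4 ^ n`. At powers of two the interval halves exactly.
  primeProduct≤4^ : ∀ j → primeProduct 0 (2 ^ j) ≤ 2 ^ (2 ^ j + 2 ^ j)
  primeProduct≤4^ zero = s≤s z≤n
  primeProduct≤4^ (suc j) = begin
    primeProduct 0 (n + (n + 0))
      ≡⟨ cong (λ m → primeProduct 0 (n + m)) (+-identityʳ n) ⟩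
    primeProduct 0 (n + n)                         ≡⟨ primeProduct-+ 0 n n ⟩
    primeProduct n n * primeProduct 0 n
      ≤⟨ *-mono-≤ (∣⇒≤ {{>-nonZero (nCk>0 (m≤m+n n n))}} (primeProduct-∣ n n (prime∣2nCn n)))
        (primeProduct≤4^ j) ⟩
    ((n + n) C n) * 2 ^ (n + n)
      ≤⟨ *-monoˡ-≤ (2 ^ (n + n)) (nCk≤2^n (n + n) n) ⟩
    2 ^ (n + n) * 2 ^ (n + n)                      ≡⟨ sym (^-distribˡ-+-* 2 (n + n) (n + n)) ⟩
    2 ^ ((n + n) + (n + n))
      ≡⟨ cong (λ m → 2 ^ ((n + m) + (n + m))) (sym (+-identityʳ n)) ⟩
    2 ^ (2 ^ suc j + 2 ^ suc j)                    ∎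
    where
    open ≤-Reasoning
    n = 2 ^ j

  -- A composite `j` below `(r+1)²` has a factor between 2 and `r`, since two factors above `r` are
  -- too large together. That factor divides one copy of `r !`, and the cofactor is at most half of
  -- `j`. So the `e` copies last until 1 or a prime remains, and the prime is at most `N`.
  ∣r!^e*primeProduct : ∀ {N r} e j .{{_ : NonZero j}} → (∀ {q} → Prime q → q ≤ j → q ≤ N) →
    j < suc r * suc r → j ≤ 2 ^ e → j ∣ (r !) ^ e * primeProduct 0 N
  ∣r!^e*primeProduct zero (suc zero) _ _ _ = 1∣ _
  ∣r!^e*primeProduct zero (suc (suc j)) _ _ (s≤s ())
  ∣r!^e*primeProduct {N} {r} (suc e) j primes≤N j<[1+r]² j≤ with prime? j
  ... | yes pj = ∣n⇒∣m*n ((r !) ^ suc e) (prime∣primeProduct N pj (primes≤N pj ≤-refl))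
  ... | no ¬pj with j ≟ 1
  ...   | yes refl = 1∣ _
  ...   | no j≢1 with ¬prime⇒composite {{n>1⇒nonTrivial (≤∧≢⇒< (>-nonZero⁻¹ j) (j≢1 ∘ sym))}} ¬pj
  ...     | composite {d} d<j (divides t j≡t*d) = bySmallFactor (d ≤? r)
    where
    1<d = nonTrivial⇒n>1 d
    1<t : 1 < t
    1<t = *-cancelʳ-< d 1 t (subst₂ _<_ (sym (*-identityˡ d)) j≡t*d d<j)
    remove : ∀ a b → j ≡ a * b → 1 < a → a ≤ r → .{{_ : NonZero b}} →
        j ∣ (r !) ^ suc e * primeProduct 0 N
    remove a@(suc _) b j≡ab 1<a a≤r =
        subst₂ _∣_ (sym j≡ab) (sym (*-assoc (r !) ((r !) ^ e) (primeProduct 0 N)))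
      (*-pres-∣ (m∣n! a≤r) (∣r!^e*primeProduct {r = r} e b
        (λ pq q≤b → primes≤N pq (≤-trans q≤b b≤j)) (≤-<-trans b≤j j<[1+r]²)
        (*-cancelˡ-≤ 2 (≤-trans (*-monoˡ-≤ b 1<a) (≤-trans (≤-reflexive (sym j≡ab)) j≤)))))
      where
      b≤j : b ≤ j
      b≤j = ≤-trans (m≤n*m b a) (≤-reflexive (sym j≡ab))
    bySmallFactor : Dec (d ≤ r) → j ∣ (r !) ^ suc e * primeProduct 0 N
    bySmallFactor (yes d≤r) = remove d t (trans j≡t*d (*-comm t d)) 1<d d≤r
        {{>-nonZero (<-trans z<s 1<t)}}
    bySmallFactor (no d≰r)  = remove t d j≡t*d 1<t t≤r {{>-nonZero (<-trans z<s 1<d)}}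
      where
      t≤r : t ≤ r
      t≤r with t ≤? r
      ... | yes t≤r = t≤r
      ... | no t≰r = contradiction
          (≤-trans (*-mono-≤ (≰⇒> t≰r) (≰⇒> d≰r)) (≤-reflexive (sym j≡t*d))) (<⇒≱ j<[1+r]²)

  -- A prime between `4 ^ i / 16` and `4 ^ i`.

  n!≤n^n : ∀ n → n ! ≤ n ^ n
  n!≤n^n zero    = ≤-refl
  n!≤n^n (suc n) = *-monoʳ-≤ (suc n) (≤-trans (n!≤n^n n) (^-monoˡ-≤ n (n≤1+n n)))

  -- This fixes the threshold 11: `16 * 121 < 2048`, whereas `16 * 100 > 1024`.
  16i²<2^i : ∀ i → 16 * ((11 + i) * (11 + i)) < 2 ^ (11 + i)
  16i²<2^i zero    = ≤ᵇ⇒≤ _ _ _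
  16i²<2^i (suc i) = begin-strict
    16 * ((12 + i) * (12 + i))
      ≤⟨ m≤m+n _ (16 * (i * i + 20 * i + 98)) ⟩
    16 * ((12 + i) * (12 + i)) + 16 * (i * i + 20 * i + 98)       ≡⟨ double i ⟩
    2 * (16 * ((11 + i) * (11 + i)))                              <⟨ *-monoʳ-< 2 (16i²<2^i i) ⟩
    2 ^ (12 + i)                                                  ∎
    where
    open ≤-Reasoning
    double : ∀ i → 16 * ((12 + i) * (12 + i)) + 16 * (i * i + 20 * i + 98) ≡
        2 * (16 * ((11 + i) * (11 + i)))
    double = solve-∀

  16*2²ⁱ≡4²⁺ⁱ : ∀ i → 16 * 2 ^ (2 * i) ≡ 4 ^ (2 + i)
  16*2²ⁱ≡4²⁺ⁱ i = trans (cong (16 *_) (sym (^-*-assoc 2 2 i))) (*-assoc 4 4 (4 ^ i))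

  -- If there is no such prime then, with r = 2^i and N = 4^i / 16, (r!)^(2i) ∏_{p ≤ N} p is a
  -- common multiple of 1, ..., 8N + 1, hence at least 2^(4N); but it is at most 2^(2 i² r + 2N).
  primeBetween : ∀ i → 11 ≤ i → ∃ λ p → Prime p × p ≤ 4 ^ i × 4 ^ i < 16 * p
  primeBetween (suc zero) (s≤s ())
  primeBetween i@(suc (suc i₀)) 11≤i
    with anyUpTo? (λ q → (prime? q) ×-dec (2 ^ (2 * i₀) <? q)) (suc (4 ^ i))
  ... | yes (p , s≤s p≤4^i , pp , N<p) =
      p , pp , p≤4^i , subst (_< 16 * p) (16*2²ⁱ≡4²⁺ⁱ i₀) (*-monoʳ-< 16 N<p)
  ... | no none = contradiction lower (<⇒≱ upper)
    where
    open ≤-Reasoning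
    -- `N` is `4 ^ i / 16`, written as a power of two to suit `primeProduct≤4^`.
    N = 2 ^ (2 * i₀)
    r = 2 ^ i
    e = i + i
    n = 4 * N
    Λ = (r !) ^ e * primeProduct 0 N
    instance
      N≢0 : NonZero N
      N≢0 = m^n≢0 2 (2 * i₀)
      Λ≢0 : NonZero Λ
      Λ≢0 = m*n≢0 ((r !) ^ e) (primeProduct 0 N) {{m^n≢0 (r !) e {{r !≢0}}}} {{primeProduct≢0 0 N}}
    16N≡4^i : 16 * N ≡ 4 ^ i
    16N≡4^i = 16*2²ⁱ≡4²⁺ⁱ i₀
    4^i≡2^e : 4 ^ i ≡ 2 ^ e
    4^i≡2^e = trans (^-*-assoc 2 2 i) (cong (λ k → 2 ^ (i + k)) (+-identityʳ i))
    r*r≡4^i : r * r ≡ 4 ^ i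
    r*r≡4^i = trans (sym (^-distribˡ-+-* 2 i i)) (sym 4^i≡2^e)
    [1+2n]≤4^i : suc (n + n) ≤ 4 ^ i
    [1+2n]≤4^i = begin
      1 + (4 * N + 4 * N)     ≤⟨ +-monoˡ-≤ (4 * N + 4 * N) (≤-trans (>-nonZero⁻¹ N) (m≤n*m N 8)) ⟩
      8 * N + (4 * N + 4 * N) ≡⟨ collect N ⟩
      16 * N                  ≡⟨ 16N≡4^i ⟩
      4 ^ i                   ∎
      where
      collect : ∀ N → 8 * N + (4 * N + 4 * N) ≡ 16 * N
      collect = solve-∀
    primes≤N : ∀ {q} → Prime q → q ≤ 4 ^ i → q ≤ N
    primes≤N pq q≤ = ≮⇒≥ λ N<q → none (_ , s≤s q≤ , pq , N<q)
    multiple : ∀ j → j ≤ n + n → suc j ∣ Λ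
    multiple j j≤2n = ∣r!^e*primeProduct {r = r} e (suc j) (λ pq q≤ → primes≤N pq (≤-trans q≤ 1+j≤))
      (≤-<-trans 1+j≤ (subst (_< suc r * suc r) r*r≡4^i (*-mono-< (n<1+n r) (n<1+n r))))
      (≤-trans 1+j≤ (≤-reflexive 4^i≡2^e))
      where
      1+j≤ : suc j ≤ 4 ^ i
      1+j≤ = ≤-trans (s≤s j≤2n) [1+2n]≤4^i
    lower : 2 ^ n ≤ Λ
    lower = begin
      2 ^ n                       ≤⟨ 2^n≤2nCn n ⟩
      (n + n) C n                 ≤⟨ m≤n*m ((n + n) C n) (suc (n + n)) ⟩
      suc (n + n) * ((n + n) C n) ≤⟨ ∣⇒≤ ([1+n]*nCk∣commonMultiple (n + n) n (m≤m+n n n) multiple) ⟩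
      Λ                           ∎
    -- Since `16 N = r * r`, this is `16 i² < 2 ^ i` multiplied by `r` and divided by 8.
    exponent : i * (r * e) < 2 * N
    exponent = *-cancelˡ-< 8 (i * (r * e)) (2 * N) (begin-strict
      8 * (i * (r * (i + i))) ≡⟨ collect i r ⟩
      16 * (i * i) * r
        <⟨ *-monoˡ-< r {{m^n≢0 2 i}}
          (subst (λ i → 16 * (i * i) < 2 ^ i) (m+[n∸m]≡n 11≤i) (16i²<2^i (i ∸ 11))) ⟩
      r * r                   ≡⟨ trans r*r≡4^i (sym 16N≡4^i) ⟩
      16 * N                  ≡⟨ *-assoc 8 2 N ⟩
      8 * (2 * N)             ∎)
      where
      collect : ∀ i r → 8 * (i * (r * (i + i))) ≡ 16 * (i * i) * r
      collect = solve-∀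
    upper : Λ < 2 ^ n
    upper = begin-strict
      (r !) ^ e * primeProduct 0 N
        ≤⟨ *-mono-≤ (^-monoˡ-≤ e (n!≤n^n r)) (primeProduct≤4^ (2 * i₀)) ⟩
      (r ^ r) ^ e * 2 ^ (N + N)
        ≡⟨ cong (_* 2 ^ (N + N)) (trans (^-*-assoc r r e) (^-*-assoc 2 i (r * e))) ⟩
      2 ^ (i * (r * e)) * 2 ^ (N + N)       ≡⟨ sym (^-distribˡ-+-* 2 (i * (r * e)) (N + N)) ⟩
      2 ^ (i * (r * e) + (N + N))
        <⟨ ^-monoʳ-< 2 (s≤s (s≤s z≤n)) (+-monoˡ-< (N + N) exponent) ⟩
      2 ^ (2 * N + (N + N))                 ≡⟨ cong (2 ^_) (collect N) ⟩
      2 ^ n                                 ∎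
      where
      collect : ∀ N → 2 * N + (N + N) ≡ 4 * N
      collect = solve-∀

  -- A prime of the order of √d for every large `d`.

  powerBelow : ∀ b .{{_ : NonTrivial b}} d .{{_ : NonZero d}} → ∃ λ i → b ^ i ≤ d × d < b ^ suc i
  powerBelow b (suc zero) = 0 , ≤-refl , ≤-trans (nonTrivial⇒n>1 b)
      (≤-reflexive (sym (*-identityʳ b)))
  powerBelow b (suc d@(suc _)) with powerBelow b d
  ... | i , bⁱ≤d , d<b¹⁺ⁱ with suc d <? b ^ suc i
  ...   | yes 1+d<b¹⁺ⁱ = i , m≤n⇒m≤1+n bⁱ≤d , 1+d<b¹⁺ⁱ
  ...   | no  1+d≮b¹⁺ⁱ = suc i , ≮⇒≥ 1+d≮b¹⁺ⁱ ,
    ≤-<-trans d<b¹⁺ⁱ (^-monoʳ-< b (nonTrivial⇒n>1 b) (n<1+n (suc i)))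

  16ⁱ≡4ⁱ*4ⁱ : ∀ i → 16 ^ i ≡ 4 ^ i * 4 ^ i
  16ⁱ≡4ⁱ*4ⁱ i = trans (^-*-assoc 4 2 i)
      (trans (cong (λ j → 4 ^ (i + j)) (+-identityʳ i)) (^-distribˡ-+-* 4 i i))

  -- The witness precedes the hypothesis `16 ^ 11 ≤ d`, so that `d` alone determines `p`, as the row
  -- count in the theorem requires; small `d` get the default 0. The constant is `64 = 4 * 16`:
  -- rounding `d` down to a power of 16 costs 4 in the root, and the prime gap costs 16.
  primeNear√ : ∀ d → ∃ λ p → 16 ^ 11 ≤ d → Prime p × p * p ≤ d × d ≤ (64 * p) * (64 * p)
  primeNear√ zero = 0 , λ ()
  primeNear√ d@(suc _) with powerBelow 16 d
  ... | i , 16ⁱ≤d , d<16¹⁺ⁱ with 11 ≤? i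
  ...   | no 11≰i = 0 , λ large → contradiction
          (≤-trans (^-monoʳ-≤ 16 (≰⇒> 11≰i)) large) (<⇒≱ d<16¹⁺ⁱ)
  ...   | yes 11≤i with primeBetween i 11≤i
  ...     | p , prime[p] , p≤4ⁱ , 4ⁱ<16p = p , λ _ → prime[p] ,
            ≤-trans (*-mono-≤ p≤4ⁱ p≤4ⁱ) (≤-trans (≤-reflexive (sym (16ⁱ≡4ⁱ*4ⁱ i))) 16ⁱ≤d) ,
            (begin
              d                                  ≤⟨ <⇒≤ d<16¹⁺ⁱ ⟩
              16 ^ suc i                         ≡⟨ 16ⁱ≡4ⁱ*4ⁱ (suc i) ⟩
              (4 * 4 ^ i) * (4 * 4 ^ i)          ≤⟨ *-mono-≤ bound bound ⟩
              (64 * p) * (64 * p)                ∎)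
    where
    open ≤-Reasoning
    bound : 4 * 4 ^ i ≤ 64 * p
    bound = ≤-trans (*-monoʳ-≤ 4 (<⇒≤ 4ⁱ<16p)) (≤-reflexive (sym (*-assoc 4 16 p)))

  ^-distribʳ-* : ∀ m n o → (m * n) ^ o ≡ m ^ o * n ^ o
  ^-distribʳ-* m n zero    = refl
  ^-distribʳ-* m n (suc o) =
      trans (cong (m * n *_) (^-distribʳ-* m n o)) (interchange m n (m ^ o) (n ^ o))
    where
    interchange : ∀ a b c d → a * b * (c * d) ≡ a * c * (b * d)
    interchange = solve-∀

  power≤ : ∀ {d} b p k → d ≤ (b * p) * (b * p) → d ^ k ≤ b ^ (k + k) * p ^ (k + k)
  power≤ {d} b p k d≤ = begin
    d ^ k                               ≤⟨ ^-monoˡ-≤ k d≤ ⟩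
    ((b * p) * (b * p)) ^ k             ≡⟨ ^-distribʳ-* (b * p) (b * p) k ⟩
    (b * p) ^ k * (b * p) ^ k           ≡⟨ sym (^-distribˡ-+-* (b * p) k k) ⟩
    (b * p) ^ (k + k)                   ≡⟨ ^-distribʳ-* b p (k + k) ⟩
    b ^ (k + k) * p ^ (k + k)           ∎
    where open ≤-Reasoning

module PolynomialGraphs where
  open import Data.Nat.Properties
  open import Algebra.Properties.Semiring.Sum +-*-semiring using
    (sum; sum-syntax; sum-cong-≗; sum-replicate-zero; ∑-distrib-+; ∑-comm; *-distribʳ-sum)
  open import Data.Bool.Base using (if_then_else_)
  open import Data.Fin.Base as Fin using
    (Fin; zero; suc; toℕ; fromℕ<; combine; inject≤; finToFun; funToFin)
  import Data.Fin.Properties as Fin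
  open import Data.Integer.Base as ℤ using (ℤ; +_)
  open import Data.Integer.DivMod using (_%ℕ_; _/ℕ_; n%ℕd<d; a≡a%ℕn+[a/ℕn]*n)
  import Data.Integer.Divisibility.Signed as ℤ∣
  import Data.Integer.Properties as ℤ
  open import Data.Integer.Tactic.RingSolver using () renaming (solve-∀ to ℤ-solve-∀)
  open import Data.List.Base using (List; []; _∷_; length)
  open import Data.List.Membership.Propositional using (_∈_)
  open import Data.List.Relation.Unary.Any using (here; there; any?)
  open import Data.Nat.Base
  open import Data.Nat.Divisibility
  open import Data.Nat.Primality
  open import Data.Product.Base using (_×_; _,_; proj₁)
  open import Data.Sum.Base using (_⊎_; inj₁; inj₂)
  open import Function.Base using (_∘_)
  open import Relation.Binary.PropositionalEquality
  open import Relation.Nullary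

  -- Counting by sums of indicators of decisions, which excluded middle may later supply.

  𝟙 : ∀ {a} {P : Set a} → Dec P → ℕ
  𝟙 P? = if does P? then 1 else 0

  𝟙-yes : ∀ {a} {P : Set a} (P? : Dec P) → P → 𝟙 P? ≡ 1
  𝟙-yes (yes _) p = refl
  𝟙-yes (no ¬p) p = contradiction p ¬p

  𝟙-no : ∀ {a} {P : Set a} (P? : Dec P) → ¬ P → 𝟙 P? ≡ 0
  𝟙-no (yes p) ¬p = contradiction p ¬p
  𝟙-no (no _)  ¬p = refl

  𝟙-mono : ∀ {a b} {P : Set a} {Q : Set b} (P? : Dec P) (Q? : Dec Q) → (P → Q) → 𝟙 P? ≤ 𝟙 Q?
  𝟙-mono (yes p) Q? f = ≤-reflexive (sym (𝟙-yes Q? (f p)))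
  𝟙-mono (no _)  Q? f = z≤n

  𝟙-cong : ∀ {a b} {P : Set a} {Q : Set b} (P? : Dec P) (Q? : Dec Q) →
    (P → Q) → (Q → P) → 𝟙 P? ≡ 𝟙 Q?
  𝟙-cong P? Q? f g = ≤-antisym (𝟙-mono P? Q? f) (𝟙-mono Q? P? g)

  sum-mono : ∀ {n} (f g : Fin n → ℕ) → (∀ i → f i ≤ g i) → sum f ≤ sum g
  sum-mono {zero}  f g f≤g = z≤n
  sum-mono {suc n} f g f≤g = +-mono-≤ (f≤g zero) (sum-mono (f ∘ suc) (g ∘ suc) (f≤g ∘ suc))

  sum-zero : ∀ {n} (f : Fin n → ℕ) → (∀ i → f i ≡ 0) → sum f ≡ 0
  sum-zero {n} f f≡0 = trans (sum-cong-≗ f≡0) (sum-replicate-zero n)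

  sum-select : ∀ {n} (a : Fin n) (v : Fin n → ℕ) → ∑[ i < n ] (𝟙 (i Fin.≟ a) * v i) ≡ v a
  sum-select {suc n} zero v =
      trans (cong₂ _+_ (*-identityˡ (v zero)) (sum-zero {n} (λ _ → 0) λ _ → refl))
      (+-identityʳ (v zero))
  sum-select (suc a) v = sum-select a (v ∘ suc)

  sum-𝟙≟ : ∀ {n} (a : Fin n) → ∑[ i < n ] 𝟙 (i Fin.≟ a) ≡ 1
  sum-𝟙≟ a = trans (sum-cong-≗ (λ i → sym (*-identityʳ (𝟙 (i Fin.≟ a))))) (sum-select a (λ _ → 1))

  ∑-𝟙∈≤length : ∀ {n} (is : List (Fin n)) → ∑[ j < n ] 𝟙 (any? (j Fin.≟_) is) ≤ length is
  ∑-𝟙∈≤length {n} [] = ≤-reflexive (sum-zero {n} (λ _ → 0) λ _ → refl)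
  ∑-𝟙∈≤length {n} (i ∷ is) = begin
    ∑[ j < n ] 𝟙 (any? (j Fin.≟_) (i ∷ is))
      ≤⟨ sum-mono {n} _ _ (λ j → cons (any? (j Fin.≟_) (i ∷ is)) (j Fin.≟ i) (any? (j Fin.≟_) is)) ⟩
    ∑[ j < n ] (𝟙 (j Fin.≟ i) + 𝟙 (any? (j Fin.≟_) is))
      ≡⟨ ∑-distrib-+ {n} (λ j → 𝟙 (j Fin.≟ i)) (λ j → 𝟙 (any? (j Fin.≟_) is)) ⟩
    ∑[ j < n ] 𝟙 (j Fin.≟ i) + ∑[ j < n ] 𝟙 (any? (j Fin.≟_) is)
      ≤⟨ +-mono-≤ (≤-reflexive (sum-𝟙≟ i)) (∑-𝟙∈≤length is) ⟩
    suc (length is) ∎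
    where
    open ≤-Reasoning
    cons : ∀ {j} (j∈i∷is? : Dec (j ∈ i ∷ is)) (j≡i? : Dec (j ≡ i)) (j∈is? : Dec (j ∈ is)) →
        𝟙 j∈i∷is? ≤ 𝟙 j≡i? + 𝟙 j∈is?
    cons (no _) _ _ = z≤n
    cons (yes (here j≡i))   j≡i? j∈is? = ≤-trans (≤-reflexive (sym (𝟙-yes j≡i? j≡i))) (m≤m+n _ _)
    cons (yes (there j∈is)) j≡i? j∈is? = ≤-trans (≤-reflexive (sym (𝟙-yes j∈is? j∈is))) (m≤n+m _ _)

  -- Later `is` lists the entries read by the algorithm, and `P` is an event that forces an entry to
  -- be read.
  ∑𝟙≤length : ∀ {n} {P : Fin n → Set} (P? : ∀ i → Dec (P i)) (is : List (Fin n)) →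
    (∀ i → P i → i ∈ is) → ∑[ i < n ] 𝟙 (P? i) ≤ length is
  ∑𝟙≤length {n} P? is P⊆is = ≤-trans
    (sum-mono {n} _ _ λ i → 𝟙-mono (P? i) (any? (i Fin.≟_) is) (P⊆is i)) (∑-𝟙∈≤length is)

  -- Integer polynomials and their roots modulo a prime.

  Coefficients : ℕ → Set
  Coefficients k = Fin k → ℤ

  -- Horner evaluation, constant coefficient first. Elements of 𝔽ₚ are represented by integers, and
  -- being zero in 𝔽ₚ by divisibility by `p`.
  ⟦_⟧ : ∀ {k} → Coefficients k → ℤ → ℤ
  ⟦_⟧ {zero}  h x = + 0
  ⟦_⟧ {suc k} h x = h zero ℤ.+ x ℤ.* ⟦ h ∘ suc ⟧ x

  ⟦⟧-minus : ∀ {k} (f g : Coefficients k) x → ⟦ (λ i → f i ℤ.- g i) ⟧ x ≡ ⟦ f ⟧ x ℤ.- ⟦ g ⟧ x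
  ⟦⟧-minus {zero}  f g x = refl
  ⟦⟧-minus {suc k} f g x = trans
    (cong (λ y → f zero ℤ.- g zero ℤ.+ x ℤ.* y) (⟦⟧-minus (f ∘ suc) (g ∘ suc) x))
    (rearrange (f zero) (g zero) x (⟦ f ∘ suc ⟧ x) (⟦ g ∘ suc ⟧ x))
    where
    rearrange : ∀ a b x y z → a ℤ.- b ℤ.+ x ℤ.* (y ℤ.- z) ≡ (a ℤ.+ x ℤ.* y) ℤ.- (b ℤ.+ x ℤ.* z)
    rearrange = ℤ-solve-∀

  -- The coefficients of the quotient of X h(X) by X - a.
  divideOut : ∀ {k} → ℤ → Coefficients k → Coefficients k
  divideOut a h zero    = ⟦ h ⟧ a
  divideOut a h (suc i) = divideOut a (h ∘ suc) i

  -- This is the factor theorem for `c + X h(X)`, whose constant cancels in the difference of two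
  -- values. The quotient has one coefficient fewer than `c + X h(X)`, as the induction on roots
  -- wants.
  divideOut-correct : ∀ {k} (h : Coefficients k) a x →
    x ℤ.* ⟦ h ⟧ x ℤ.- a ℤ.* ⟦ h ⟧ a ≡ (x ℤ.- a) ℤ.* ⟦ divideOut a h ⟧ x
  divideOut-correct {zero} h a x = collapse a x
    where
    collapse : ∀ a x → x ℤ.* + 0 ℤ.- a ℤ.* + 0 ≡ (x ℤ.- a) ℤ.* + 0
    collapse = ℤ-solve-∀
  divideOut-correct {suc k} h a x = begin
    x ℤ.* (c ℤ.+ x ℤ.* E) ℤ.- a ℤ.* (c ℤ.+ a ℤ.* F)                ≡⟨ split x a c E F ⟩
    (x ℤ.- a) ℤ.* (c ℤ.+ a ℤ.* F) ℤ.+ x ℤ.* (x ℤ.* E ℤ.- a ℤ.* F)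
      ≡⟨ cong (λ y → (x ℤ.- a) ℤ.* (c ℤ.+ a ℤ.* F) ℤ.+ x ℤ.* y) (divideOut-correct (h ∘ suc) a x) ⟩
    (x ℤ.- a) ℤ.* (c ℤ.+ a ℤ.* F) ℤ.+ x ℤ.* ((x ℤ.- a) ℤ.* W)      ≡⟨ merge x a (c ℤ.+ a ℤ.* F) W ⟩
    (x ℤ.- a) ℤ.* (c ℤ.+ a ℤ.* F ℤ.+ x ℤ.* W)                      ∎
    where
    open ≡-Reasoning
    c = h zero
    E = ⟦ h ∘ suc ⟧ x
    F = ⟦ h ∘ suc ⟧ a
    W = ⟦ divideOut a (h ∘ suc) ⟧ x
    split : ∀ x a c E F → x ℤ.* (c ℤ.+ x ℤ.* E) ℤ.- a ℤ.* (c ℤ.+ a ℤ.* F) ≡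
      (x ℤ.- a) ℤ.* (c ℤ.+ a ℤ.* F) ℤ.+ x ℤ.* (x ℤ.* E ℤ.- a ℤ.* F)
    split = ℤ-solve-∀
    merge : ∀ x a u W → (x ℤ.- a) ℤ.* u ℤ.+ x ℤ.* ((x ℤ.- a) ℤ.* W) ≡ (x ℤ.- a) ℤ.* (u ℤ.+ x ℤ.* W)
    merge = ℤ-solve-∀

  ⟦⟧-∣ : ∀ {k z} (h : Coefficients k) x → (∀ i → z ℤ∣.∣ h i) → z ℤ∣.∣ ⟦ h ⟧ x
  ⟦⟧-∣ {zero}  h x z∣h = ℤ∣.∣ᵤ⇒∣ (_ ∣0)
  ⟦⟧-∣ {suc k} h x z∣h = ℤ∣.∣m∣n⇒∣m+n (z∣h zero) (ℤ∣.∣n⇒∣m*n x (⟦⟧-∣ (h ∘ suc) x (z∣h ∘ suc)))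

  -- Each coefficient of the quotient is the one of `h` plus `a` times a combination of later ones,
  -- so `h` is recovered from the last coefficient backwards. Hence dividing out a root keeps a
  -- polynomial nonzero modulo `p`.
  divideOut-∣⇒∣ : ∀ {k z} a (h : Coefficients k) → (∀ i → z ℤ∣.∣ divideOut a h i) → ∀ i → z ℤ∣.∣ h i
  divideOut-∣⇒∣ {suc k} a h z∣q zero = ℤ∣.∣m+n∣n⇒∣m (z∣q zero)
    (ℤ∣.∣n⇒∣m*n a (⟦⟧-∣ (h ∘ suc) a (divideOut-∣⇒∣ a (h ∘ suc) (z∣q ∘ suc))))
  divideOut-∣⇒∣ {suc k} a h z∣q (suc i) = divideOut-∣⇒∣ a (h ∘ suc) (z∣q ∘ suc) i

  at : ∀ {p} → Fin p → ℤ
  at x = + toℕ x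

  ∣toℕ-toℕ⇒≡ : ∀ {p} (x y : Fin p) → + p ℤ∣.∣ at x ℤ.- at y → x ≡ y
  ∣toℕ-toℕ⇒≡ {p} x y p∣x-y =
      Fin.toℕ-injective (ℤ.+-injective (ℤ.i-j≡0⇒i≡j (at x) (at y) (ℤ.∣i∣≡0⇒i≡0 small)))
    where
    d = ℤ.∣ at x ℤ.- at y ∣
    d<p : d < p
    d<p = ≤-<-trans (≤-trans (≤-reflexive (cong ℤ.∣_∣ (ℤ.m-n≡m⊖n (toℕ x) (toℕ y))))
        (ℤ.∣m⊝n∣≤m⊔n (toℕ x) (toℕ y)))
      (⊔-lub (Fin.toℕ<n x) (Fin.toℕ<n y))
    small : d ≡ 0
    small with d in eq | ℤ∣.∣⇒∣ᵤ p∣x-y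
    ... | zero  | _   = refl
    ... | suc _ | p∣d = contradiction p∣d (>⇒∤ (subst (_< p) eq d<p))

  module _ {p} (prime[p] : Prime p) where

    euclidsLemmaℤ : ∀ x y → + p ℤ∣.∣ x ℤ.* y → + p ℤ∣.∣ x ⊎ + p ℤ∣.∣ y
    euclidsLemmaℤ x y p∣xy with euclidsLemma ℤ.∣ x ∣ ℤ.∣ y ∣ prime[p]
        (subst (p ∣_) (ℤ.abs-* x y) (ℤ∣.∣⇒∣ᵤ p∣xy))
    ... | inj₁ p∣x = inj₁ (ℤ∣.∣ᵤ⇒∣ p∣x)
    ... | inj₂ p∣y = inj₂ (ℤ∣.∣ᵤ⇒∣ p∣y)

    -- Lagrange's bound: once a root `a` is found, primality makes every other root a root of the
    -- quotient. The bound counts coefficients, one more than the degree.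
    ∑-roots≤length : ∀ {k} (h : Coefficients k) → ¬ (∀ i → + p ℤ∣.∣ h i) →
      ∑[ x < p ] 𝟙 (+ p ℤ∣.∣? ⟦ h ⟧ (at x)) ≤ k
    ∑-roots≤length {zero} h p∤h = contradiction (λ ()) p∤h
    ∑-roots≤length {suc k} h p∤h with Fin.any? (λ (x : Fin p) → + p ℤ∣.∣? ⟦ h ⟧ (at x))
    ... | no none = ≤-trans (≤-reflexive
        (sum-zero (λ x → 𝟙 (+ p ℤ∣.∣? ⟦ h ⟧ (at x)))
          λ x → 𝟙-no (+ p ℤ∣.∣? ⟦ h ⟧ (at x)) λ root → none (x , root))) z≤n
    ... | yes (a , p∣h[a]) = begin
      ∑[ x < p ] 𝟙 (+ p ℤ∣.∣? ⟦ h ⟧ (at x))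
        ≤⟨ sum-mono _ _ (λ x → other x (+ p ℤ∣.∣? ⟦ h ⟧ (at x))) ⟩
      ∑[ x < p ] (𝟙 (x Fin.≟ a) + 𝟙 (+ p ℤ∣.∣? ⟦ q ⟧ (at x)))
        ≡⟨ ∑-distrib-+ (λ x → 𝟙 (x Fin.≟ a)) (λ x → 𝟙 (+ p ℤ∣.∣? ⟦ q ⟧ (at x))) ⟩
      ∑[ x < p ] 𝟙 (x Fin.≟ a) + ∑[ x < p ] 𝟙 (+ p ℤ∣.∣? ⟦ q ⟧ (at x))
        ≤⟨ +-mono-≤ (≤-reflexive (sum-𝟙≟ a)) (∑-roots≤length q p∤q) ⟩
      suc k ∎
      where
      open ≤-Reasoning
      q = divideOut (at a) (h ∘ suc)
      p∤q : ¬ (∀ i → + p ℤ∣.∣ q i)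
      p∤q p∣q = p∤h λ
        { zero    → ℤ∣.∣m+n∣n⇒∣m p∣h[a] (ℤ∣.∣n⇒∣m*n (at a) (⟦⟧-∣ (h ∘ suc) (at a) p∣tail))
        ; (suc i) → p∣tail i }
        where
        p∣tail = divideOut-∣⇒∣ (at a) (h ∘ suc) p∣q
      difference : ∀ c x y → c ℤ.+ x ℤ.- (c ℤ.+ y) ≡ x ℤ.- y
      difference = ℤ-solve-∀
      other : ∀ x (root? : Dec (+ p ℤ∣.∣ ⟦ h ⟧ (at x))) →
          𝟙 root? ≤ 𝟙 (x Fin.≟ a) + 𝟙 (+ p ℤ∣.∣? ⟦ q ⟧ (at x))
      other x (no _) = z≤n
      other x (yes p∣h[x]) with euclidsLemmaℤ (at x ℤ.- at a) (⟦ q ⟧ (at x)) (subst (+ p ℤ∣.∣_)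
              (trans (difference (h zero) _ _) (divideOut-correct (h ∘ suc) (at a) (at x)))
                (ℤ∣.∣m∣n⇒∣m-n p∣h[x] p∣h[a]))
      ... | inj₁ p∣x-a = ≤-trans
          (≤-reflexive (sym (𝟙-yes (x Fin.≟ a) (∣toℕ-toℕ⇒≡ x a p∣x-a)))) (m≤m+n _ _)
      ... | inj₂ p∣q[x] = ≤-trans
          (≤-reflexive (sym (𝟙-yes (+ p ℤ∣.∣? ⟦ q ⟧ (at x)) p∣q[x]))) (m≤n+m _ _)

  -- The graphs of polynomials over 𝔽ₚ and their inner products.

  funToFin-cong : ∀ {m n} {f g : Fin m → Fin n} → (∀ i → f i ≡ g i) → funToFin f ≡ funToFin g
  funToFin-cong {zero}  f≗g = refl
  funToFin-cong {suc m} f≗g = cong₂ combine (f≗g zero) (funToFin-cong (f≗g ∘ suc))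

  finToFun-injective : ∀ {m n} (i j : Fin (m ℕ.^ n)) →
      (∀ t → finToFun {m} {n} i t ≡ finToFun {m} {n} j t) → i ≡ j
  finToFun-injective {m} {n} i j eq = trans (sym (Fin.funToFin-finToFin {n} {m} i))
    (trans (funToFin-cong eq) (Fin.funToFin-finToFin {n} {m} j))

  -- The f-th row of the design matrix is the indicator, among the first p * p columns seen as
  -- points of 𝔽ₚ × 𝔽ₚ, of the graph of the f-th polynomial over 𝔽ₚ with k coefficients.
  module _ {p} (prime[p] : Prime p) (k : ℕ) {d} (p*p≤d : p * p ≤ d) where

    private instance
      p≢0 : NonZero p
      p≢0 = prime⇒nonZero prime[p]

    coefficients : Fin (p ℕ.^ k) → Coefficients k
    coefficients f i = at (finToFun {p} {k} f i)

    value : Fin (p ℕ.^ k) → Fin p → Fin p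
    value f x = fromℕ< (n%ℕd<d (⟦ coefficients f ⟧ (at x)) p)

    value≡⇒∣ : ∀ f g x → value f x ≡ value g x →
        + p ℤ∣.∣ ⟦ coefficients f ⟧ (at x) ℤ.- ⟦ coefficients g ⟧ (at x)
    value≡⇒∣ f g x eq = ℤ∣.divides (u /ℕ p ℤ.- v /ℕ p) (begin
      u ℤ.- v
        ≡⟨ cong₂ ℤ._-_ (a≡a%ℕn+[a/ℕn]*n u p) (a≡a%ℕn+[a/ℕn]*n v p) ⟩
      (+ (u %ℕ p) ℤ.+ u /ℕ p ℤ.* + p) ℤ.- (+ (v %ℕ p) ℤ.+ v /ℕ p ℤ.* + p)
        ≡⟨ cong (λ r → (+ r ℤ.+ u /ℕ p ℤ.* + p) ℤ.- (+ (v %ℕ p) ℤ.+ v /ℕ p ℤ.* + p)) sameRemainder ⟩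
      (+ (v %ℕ p) ℤ.+ u /ℕ p ℤ.* + p) ℤ.- (+ (v %ℕ p) ℤ.+ v /ℕ p ℤ.* + p)
        ≡⟨ factor (+ (v %ℕ p)) (u /ℕ p) (v /ℕ p) (+ p) ⟩
      (u /ℕ p ℤ.- v /ℕ p) ℤ.* + p ∎)
      where
      open ≡-Reasoning
      u = ⟦ coefficients f ⟧ (at x)
      v = ⟦ coefficients g ⟧ (at x)
      sameRemainder : u %ℕ p ≡ v %ℕ p
      sameRemainder = trans (sym (Fin.toℕ-fromℕ< (n%ℕd<d u p)))
          (trans (cong toℕ eq) (Fin.toℕ-fromℕ< (n%ℕd<d v p)))
      factor : ∀ r a b c → (r ℤ.+ a ℤ.* c) ℤ.- (r ℤ.+ b ℤ.* c) ≡ (a ℤ.- b) ℤ.* c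
      factor = ℤ-solve-∀

    agreements : Fin (p ℕ.^ k) → Fin (p ℕ.^ k) → ℕ
    agreements f g = ∑[ x < p ] 𝟙 (value f x Fin.≟ value g x)

    agreements-refl : ∀ f → agreements f f ≡ p
    agreements-refl f = trans (sum-cong-≗ {p} λ x →
        𝟙-yes (value f x Fin.≟ value f x) refl) (count p)
      where
      count : ∀ n → ∑[ x < n ] 1 ≡ n
      count zero    = refl
      count (suc n) = cong suc (count n)

    -- Agreements are roots of the difference modulo `p`. The coefficients are base `p` digits of
    -- the index, so distinct indices differ in some digit, and digits congruent modulo `p` are
    -- equal: the difference is nonzero.
    agreements-≢ : ∀ {f g} → f ≢ g → agreements f g ≤ k
    agreements-≢ {f} {g} f≢g = ≤-trans
      (sum-mono _ _ λ x → 𝟙-mono (value f x Fin.≟ value g x) (+ p ℤ∣.∣? ⟦ h ⟧ (at x))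
        λ eq → subst (+ p ℤ∣.∣_) (sym (⟦⟧-minus (coefficients f) (coefficients g) (at x)))
            (value≡⇒∣ f g x eq))
      (∑-roots≤length prime[p] h λ p∣h →
        f≢g (finToFun-injective {p} {k} f g λ i → ∣toℕ-toℕ⇒≡ _ _ (p∣h i)))
      where
      h : Coefficients k
      h i = coefficients f i ℤ.- coefficients g i

    column : Fin p → Fin p → Fin d
    column x y = inject≤ (combine x y) p*p≤d

    column-injective : ∀ x y x′ y′ → column x y ≡ column x′ y′ → x ≡ x′ × y ≡ y′
    column-injective x y x′ y′ eq =
        Fin.combine-injective x y x′ y′ (Fin.inject≤-injective p*p≤d p*p≤d _ _ eq)

    -- A sum over the points of the graph, so that an inner product is evaluated by exchanging two
    -- sums and applying `sum-select`.
    row : Fin (p ℕ.^ k) → Fin d → ℕ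
    row f c = ∑[ x < p ] 𝟙 (c Fin.≟ column x (value f x))

    row-column : ∀ f x y → row f (column x y) ≡ 𝟙 (y Fin.≟ value f x)
    row-column f x y with y Fin.≟ value f x
    ... | yes refl = trans (sum-cong-≗ λ x′ →
        𝟙-cong (column x y Fin.≟ column x′ (value f x′)) (x′ Fin.≟ x)
                             (λ eq → sym (proj₁ (column-injective _ _ _ _ eq))) λ { refl → refl })
                           (sum-𝟙≟ x)
    ... | no y≢    = sum-zero {p} _ λ x′ → 𝟙-no (column x y Fin.≟ column x′ (value f x′)) λ eq →
        y≢ (onGraph x′ (column-injective _ _ _ _ eq))
      where
      onGraph : ∀ x′ → x ≡ x′ × y ≡ value f x′ → y ≡ value f x
      onGraph x′ (refl , eq) = eq

    row·row : ∀ f g → ∑[ c < d ] (row f c * row g c) ≡ agreements f g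
    row·row f g = begin
      ∑[ c < d ] (row f c * row g c)
        ≡⟨ sum-cong-≗ (λ c → *-distribʳ-sum (row g c) (λ x → 𝟙 (c Fin.≟ column x (value f x)))) ⟩
      ∑[ c < d ] ∑[ x < p ] (𝟙 (c Fin.≟ column x (value f x)) * row g c)
        ≡⟨ ∑-comm (λ c x → 𝟙 (c Fin.≟ column x (value f x)) * row g c) ⟩
      ∑[ x < p ] ∑[ c < d ] (𝟙 (c Fin.≟ column x (value f x)) * row g c)
        ≡⟨ sum-cong-≗ (λ x → sum-select (column x (value f x)) (row g)) ⟩
      ∑[ x < p ] row g (column x (value f x))
        ≡⟨ sum-cong-≗ (λ x → row-column g x (value f x)) ⟩
      agreements f g ∎
      where open ≡-Reasoning

module LowerBound (em : ExcludedMiddle 0ℓ) (ℝ : CompleteOrderedField) where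
  open PolynomialGraphs

  open RealAnalysis em ℝ public
  open CompleteOrderedField ℝ public
    hiding (Carrier; _≈_; _≤_; _+_; _*_; -_; _-_; 0#; 1#; zero)
  open import Algebra.Construct.NaturalChoice.Max totalOrder using (x≤x⊔y; x≤y⊔x; ⊔-lub)
  open import Algebra.Properties.AbelianGroup +-abelianGroup using (⁻¹-anti-homo‿-)
  open import Algebra.Properties.CommutativeSemigroup +-commutativeSemigroup
    using () renaming (interchange to +-interchange; x∙yz≈y∙xz to x+[y+z]≈y+[x+z])
  open import Algebra.Properties.CommutativeSemigroup *-commutativeSemigroup public
    using () renaming (x∙yz≈y∙xz to x*[y*z]≈y*[x*z])
  open import Algebra.Properties.Ring ring using (-0#≈0#)
  open import Algebra.Properties.Semiring.Exp semiring using (^-assocʳ)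
  open import Algebra.Properties.Semiring.Mult semiring using (×-homo-+; ×1-homo-*)
  open import Algebra.Properties.Semiring.Sum semiring
    using (sum-cong-≋; sum-replicate-zero; sum-init-last; ∑-distrib-+; *-distribˡ-sum)
  open import Data.Empty using (⊥; ⊥-elim)
  open import Data.Fin.Base using (Fin; zero; suc; toℕ)
  import Data.Fin.Properties as Fin
  open import Data.List.Base using (List; []; _∷_; length)
  open import Data.List.Membership.Propositional using () renaming (_∈_ to _∈ₗ_)
  open import Data.List.Relation.Unary.Any using (here; there; any?)
  open import Data.Nat.Base using (zero; suc)
  open import Data.Nat.Primality using (Prime)
  import Data.Nat.Properties as ℕ
  open import Algebra.Properties.Semiring.Sum ℕ.+-*-semiring using () renaming (sum to ℕsum)
  open import Data.Product.Base using (_,_; proj₁; proj₂)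
  open import Data.Sum.Base using (_⊎_; inj₁; inj₂)
  open import Data.Vec.Functional using (Vector)
  open import Function.Base using (_∘_)
  open import Relation.Binary.Bundles using (TotalOrder)
  open TotalOrder totalOrder public
    using (total; antisym; poset)
    renaming (refl to ≤-refl; trans to ≤-trans; reflexive to ≤-reflexive)
  open import Relation.Binary.PropositionalEquality as ≡ using (_≡_; _≢_)
  open import Relation.Binary.Reasoning.PartialOrder poset
  open import Relation.Nullary.Decidable.Core using (yes; no)
  open import Relation.Nullary.Negation.Core using (¬_; contradiction)
  open import Relation.Unary using (Pred; _∈_; _⊆_; _≐_; U; ∁; ∅; ⋃; _∪_; _∩_)

  -- Arithmetic in the ordered field.

  +-monoˡ-≤ : ∀ z {x y} → x ≤ y → x + z ≤ y + z
  +-monoˡ-≤ z {x} {y} x≤y = ≤-resp (+-comm z x) (+-comm z y) (+-monoʳ-≤ z x≤y)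

  +-mono-≤ : ∀ {x y u v} → x ≤ y → u ≤ v → x + u ≤ y + v
  +-mono-≤ {y = y} {u} x≤y u≤v = ≤-trans (+-monoˡ-≤ u x≤y) (+-monoʳ-≤ y u≤v)

  +-cancelˡ-≤ : ∀ z {x y} → z + x ≤ z + y → x ≤ y
  +-cancelˡ-≤ z {x} {y} h = ≤-resp (undo x) (undo y) (+-monoʳ-≤ (- z) h)
    where
    undo : ∀ x → - z + (z + x) ≈ x
    undo x = trans (sym (+-assoc (- z) z x)) (trans (+-congʳ (-‿inverseˡ z)) (+-identityˡ x))

  x≤x+y : ∀ {x y} → 0# ≤ y → x ≤ x + y
  x≤x+y {x} 0≤y = ≤-resp (+-identityʳ x) refl (+-monoʳ-≤ x 0≤y)

  fromℕ-+ : ∀ m n → fromℕ (m ℕ.+ n) ≈ fromℕ m + fromℕ n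
  fromℕ-+ = ×-homo-+ 1#

  fromℕ-* : ∀ m n → fromℕ (m ℕ.* n) ≈ fromℕ m * fromℕ n
  fromℕ-* = ×1-homo-*

  fromℕ-suc-* : ∀ n x → fromℕ (suc n) * x ≈ x + fromℕ n * x
  fromℕ-suc-* n x = trans (distribʳ x 1# (fromℕ n)) (+-congʳ (*-identityˡ x))

  fromℕ-^ : ∀ m n → fromℕ (m ℕ.^ n) ≈ fromℕ m ^ n
  fromℕ-^ m zero    = +-identityʳ 1#
  fromℕ-^ m (suc n) = trans (fromℕ-* m (m ℕ.^ n)) (*-congˡ (fromℕ-^ m n))

  sum-mono-≤ : ∀ {n} (f g : Vector Carrier n) → (∀ i → f i ≤ g i) → sum f ≤ sum g
  sum-mono-≤ {zero}  f g f≤g = ≤-refl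
  sum-mono-≤ {suc n} f g f≤g = +-mono-≤ (f≤g zero) (sum-mono-≤ (f ∘ suc) (g ∘ suc) (f≤g ∘ suc))

  sum-const-1 : ∀ n → ∑[ i < n ] 1# ≈ fromℕ n
  sum-const-1 zero    = refl
  sum-const-1 (suc n) = +-congˡ (sum-const-1 n)

  ∑-snoc : ∀ (f : ℕ → Carrier) N → ∑[ k < suc N ] f (toℕ k) ≈ ∑[ k < N ] f (toℕ k) + f N
  ∑-snoc f N = trans (sum-init-last {N} (f ∘ toℕ)) (+-cong
    (sum-cong-≋ {N} λ k → reflexive (≡.cong f (Fin.toℕ-inject₁ k)))
    (reflexive (≡.cong f (Fin.toℕ-fromℕ N))))

  positive-reciprocal : ∀ n .{{_ : NonZero n}} → ∃ λ y → 0# < y × y * fromℕ n ≈ 1#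
  positive-reciprocal n with inverse (fromℕ n) (λ n≈0 → 1≰0 (≤-trans (1≤fromℕ n) (≤-reflexive n≈0)))
  ... | y , ny≈1 = y ,
    (0≤y , λ 0≈y → 0≉1 (trans (sym (zeroʳ (fromℕ n))) (trans (*-congˡ 0≈y) ny≈1))) ,
    trans (*-comm y (fromℕ n)) ny≈1
    where
    0≤y : 0# ≤ y
    0≤y with total 0# y
    ... | inj₁ 0≤y = 0≤y
    ... | inj₂ y≤0 = contradiction (≤-resp ny≈1 (zeroʳ (fromℕ n)) (*-monoˡ-≤ (0≤fromℕ n) y≤0)) 1≰0

  -- Finite additivity and counting of overlapping events.

  module Events (space : ProbabilitySpace) where
    open ProbabilitySpace space

    measurable-∅ : Measurable ∅
    measurable-∅ = measurable-≐ ((λ ¬u → ¬u _) , λ ()) (measurable-∁ measurable-U)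

    pair : Pred Ω 0ℓ → Pred Ω 0ℓ → ℕ → Pred Ω 0ℓ
    pair E F zero          = E
    pair E F (suc zero)    = F
    pair E F (suc (suc _)) = ∅

    measurable-pair : ∀ {E F} → Measurable E → Measurable F → ∀ i → Measurable (pair E F i)
    measurable-pair mE mF zero          = mE
    measurable-pair mE mF (suc zero)    = mF
    measurable-pair mE mF (suc (suc _)) = measurable-∅

    ⋃-pair : ∀ {E F} → ⋃ ℕ (pair E F) ≐ (E ∪ F)
    ⋃-pair = (λ { (zero , e) → inj₁ e ; (suc zero , f) → inj₂ f }) ,
             λ { (inj₁ e) → 0 , e ; (inj₂ f) → 1 , f }

    measurable-∪ : ∀ {E F} → Measurable E → Measurable F → Measurable (E ∪ F)
    measurable-∪ mE mF = measurable-≐ ⋃-pair (measurable-⋃ _ (measurable-pair mE mF))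

    measurable-∩ : ∀ {E F} → Measurable E → Measurable F → Measurable (E ∩ F)
    measurable-∩ {E} {F} mE mF =
        measurable-≐ deMorgan (measurable-∁ (measurable-∪ (measurable-∁ mE) (measurable-∁ mF)))
      where
      deMorgan : ∁ (∁ E ∪ ∁ F) ≐ (E ∩ F)
      deMorgan = (λ {ω} h → byContradiction (h ∘ inj₁) , byContradiction (h ∘ inj₂)) ,
        λ { (e , f) (inj₁ ¬e) → ¬e e ; (e , f) (inj₂ ¬f) → ¬f f }
        where
        byContradiction : ∀ {P : Set} → ¬ ¬ P → P
        byContradiction {P} ¬¬p with em {P = P}
        ... | yes p = p
        ... | no ¬p = ⊥-elim (¬¬p ¬p)

    -- Countable additivity for the constantly empty sequence bounds its second partial sum:
    -- `ℙ ∅ + ℙ ∅ ≤ ℙ ∅`.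
    ℙ-∅ : ℙ ∅ ≈ 0#
    ℙ-∅ = antisym
      (+-cancelˡ-≤ p (≤-resp (+-congˡ (+-identityʳ p))
        (trans (ℙ-≐ (measurable-⋃ _ λ _ → measurable-∅) ⋃∅) (sym (+-identityʳ p)))
        (proj₁ (ℙ-⋃ (λ _ → ∅) (λ _ → measurable-∅) (λ ())) _ (2 , refl))))
      (ℙ-nonNeg measurable-∅)
      where
      p = ℙ ∅
      ⋃∅ : ⋃ ℕ (λ _ → ∅) ≐ ∅
      ⋃∅ = proj₂ , λ ()

    ℙ-∪ : ∀ {E F} → Measurable E → Measurable F → (∀ {ω} → ω ∈ E → ω ∈ F → ⊥) →
        ℙ (E ∪ F) ≈ ℙ E + ℙ F
    ℙ-∪ {E} {F} mE mF disjoint = trans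
      (sym (ℙ-≐ (measurable-⋃ _ (measurable-pair mE mF)) ⋃-pair))
      (antisym (proj₂ lub (ℙ E + ℙ F) bound)
        (≤-resp (+-congˡ (+-identityʳ (ℙ F))) refl (proj₁ lub _ (2 , refl))))
      where
      pair-disjoint : ∀ {i j ω} → ω ∈ pair E F i → ω ∈ pair E F j → i ≡ j
      pair-disjoint {zero}     {zero}     e f = ≡.refl
      pair-disjoint {zero}     {suc zero} e f = ⊥-elim (disjoint e f)
      pair-disjoint {suc zero} {zero}     f e = ⊥-elim (disjoint e f)
      pair-disjoint {suc zero} {suc zero} e f = ≡.refl
      lub = ℙ-⋃ (pair E F) (measurable-pair mE mF) (λ {i} → pair-disjoint {i})
      tail : ∀ N → ∑[ i < N ] ℙ (pair E F (suc (suc (toℕ i)))) ≈ 0#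
      tail N = trans (sum-cong-≋ {N} λ _ → ℙ-∅) (sum-replicate-zero N)
      bound : ∀ s → (∃ λ N → s ≈ ∑[ i < N ] ℙ (pair E F (toℕ i))) → s ≤ ℙ E + ℙ F
      bound s (zero , s≈) = ≤-resp (trans (+-identityʳ 0#) (sym s≈)) refl
          (+-mono-≤ (ℙ-nonNeg mE) (ℙ-nonNeg mF))
      bound s (suc zero , s≈) = ≤-resp (sym s≈) refl (+-monoʳ-≤ (ℙ E) (ℙ-nonNeg mF))
      bound s (suc (suc N) , s≈) =
          ≤-reflexive (trans s≈ (+-congˡ (trans (+-congˡ (tail N)) (+-identityʳ (ℙ F)))))

    ℙ-split : ∀ {E H} → Measurable E → Measurable H → ℙ E ≈ ℙ (E ∩ H) + ℙ (E ∩ ∁ H)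
    ℙ-split {E} {H} mE mH = trans
      (ℙ-≐ mE ((λ {ω} e → decide ω e) , λ { (inj₁ (e , _)) → e ; (inj₂ (e , _)) → e }))
      (ℙ-∪ (measurable-∩ mE mH) (measurable-∩ mE (measurable-∁ mH)) λ { (_ , h) (_ , ¬h) → ¬h h })
      where
      decide : ∀ ω → ω ∈ E → ω ∈ ((E ∩ H) ∪ (E ∩ ∁ H))
      decide ω e with em {P = H ω}
      ... | yes h = inj₁ (e , h)
      ... | no ¬h = inj₂ (e , ¬h)

    ℙ-mono : ∀ {E F} → Measurable E → Measurable F → E ⊆ F → ℙ E ≤ ℙ F
    ℙ-mono {E} {F} mE mF E⊆F =
        ≤-resp (sym (ℙ-≐ mE ((λ e → E⊆F e , e) , proj₂))) (sym (ℙ-split mF mE))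
      (x≤x+y (ℙ-nonNeg (measurable-∩ mF (measurable-∁ mE))))

    ℙ-∩-lower : ∀ {E F} → Measurable E → Measurable F → ℙ E + ℙ F ≤ 1# + ℙ (E ∩ F)
    ℙ-∩-lower {E} {F} mE mF = begin
      ℙ E + ℙ F                         ≈⟨ +-congʳ (ℙ-split mE mF) ⟩
      ℙ (E ∩ F) + ℙ (E ∩ ∁ F) + ℙ F     ≈⟨ trans (+-assoc _ _ _) (+-comm _ _) ⟩
      ℙ (E ∩ ∁ F) + ℙ F + ℙ (E ∩ F)     ≈⟨ +-congʳ (sym (ℙ-∪ mE∖F mF λ { (_ , ¬f) f → ¬f f })) ⟩
      ℙ ((E ∩ ∁ F) ∪ F) + ℙ (E ∩ F)
        ≤⟨ +-monoˡ-≤ _ (≤-resp refl ℙ-U (ℙ-mono (measurable-∪ mE∖F mF) measurable-U λ _ → _)) ⟩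
      1# + ℙ (E ∩ F)                    ∎
      where mE∖F = measurable-∩ mE (measurable-∁ mF)

    -- Integrating the number of events that hold over `E` would give this at once. Instead `E` is
    -- split along the first event: on the part inside it, the other events have multiplicity at
    -- most `k - 1`; on the part outside, still at most `k`.
    ∑-ℙ≤multiplicity : ∀ {n} (H : Fin n → Pred Ω 0ℓ) → (∀ i → Measurable (H i)) →
      ∀ {E} k → Measurable E → (∀ {ω} → ω ∈ E → ℕsum (λ i → 𝟙 (em {P = H i ω})) ℕ.≤ k) →
      ∑[ i < n ] ℙ (E ∩ H i) ≤ fromℕ k * ℙ E
    ∑-ℙ≤multiplicity {zero} H mH k mE multiplicity = *-nonNeg (0≤fromℕ k) (ℙ-nonNeg mE)
    ∑-ℙ≤multiplicity {suc n} H mH {E} k mE multiplicity = begin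
      ℙ A + ∑[ i < n ] ℙ (E ∩ H (suc i))
        ≈⟨ +-congˡ (sum-cong-≋ {n} splitEach) ⟩
      ℙ A + ∑[ i < n ] (ℙ (A ∩ H (suc i)) + ℙ (B ∩ H (suc i)))
        ≈⟨ +-congˡ (∑-distrib-+ {n} (λ i → ℙ (A ∩ H (suc i))) (λ i → ℙ (B ∩ H (suc i)))) ⟩
      ℙ A + (∑[ i < n ] ℙ (A ∩ H (suc i)) + ∑[ i < n ] ℙ (B ∩ H (suc i)))
        ≈⟨ sym (+-assoc _ _ _) ⟩
      ℙ A + ∑[ i < n ] ℙ (A ∩ H (suc i)) + ∑[ i < n ] ℙ (B ∩ H (suc i))
        ≤⟨ +-mono-≤ (onA k multiplicity) (∑-ℙ≤multiplicity (H ∘ suc) (mH ∘ suc) k mB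
             λ { (e , _) → ℕ.≤-trans (ℕ.m≤n+m _ _) (multiplicity e) }) ⟩
      fromℕ k * ℙ A + fromℕ k * ℙ B
        ≈⟨ sym (distribˡ (fromℕ k) (ℙ A) (ℙ B)) ⟩
      fromℕ k * (ℙ A + ℙ B)
        ≈⟨ *-congˡ (sym (ℙ-split mE (mH zero))) ⟩
      fromℕ k * ℙ E ∎
      where
      A = E ∩ H zero
      B = E ∩ ∁ (H zero)
      mA = measurable-∩ mE (mH zero)
      mB = measurable-∩ mE (measurable-∁ (mH zero))
      splitEach : ∀ i → ℙ (E ∩ H (suc i)) ≈ ℙ (A ∩ H (suc i)) + ℙ (B ∩ H (suc i))
      splitEach i = trans (ℙ-split (measurable-∩ mE (mH (suc i))) (mH zero)) (+-cong
        (ℙ-≐ (measurable-∩ (measurable-∩ mE (mH (suc i))) (mH zero)) (swap , swap))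
        (ℙ-≐ (measurable-∩ (measurable-∩ mE (mH (suc i))) (measurable-∁ (mH zero))) (swap , swap)))
        where
        swap : ∀ {P Q R : Set} → (P × Q) × R → (P × R) × Q
        swap ((x , y) , z) = (x , z) , y
      rest = λ ω → ℕsum (λ i → 𝟙 (em {P = H (suc i) ω}))
      1+rest≤ : ∀ {ω k} → ℕsum (λ i → 𝟙 (em {P = H i ω})) ℕ.≤ k → ω ∈ H zero → suc (rest ω) ℕ.≤ k
      1+rest≤ {ω} m≤k h = ≡.subst (λ x → x ℕ.+ rest ω ℕ.≤ _) (𝟙-yes em h) m≤k
      onA : ∀ k → (∀ {ω} → ω ∈ E → ℕsum (λ i → 𝟙 (em {P = H i ω})) ℕ.≤ k) →
        ℙ A + ∑[ i < n ] ℙ (A ∩ H (suc i)) ≤ fromℕ k * ℙ A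
      -- With `k = 0` no point of `E` lies in any of the events, so `A` and all its parts are null.
      onA zero m≤0 = ≤-reflexive (trans (trans
        (+-cong (null mA (λ a → a))
          (trans (sum-cong-≋ {n} λ i → null (measurable-∩ mA (mH (suc i))) proj₁)
          (sum-replicate-zero n)))
        (+-identityʳ 0#)) (sym (zeroˡ (ℙ A))))
        where
        null : ∀ {F} → Measurable F → F ⊆ A → ℙ F ≈ 0#
        null mF F⊆A = trans (ℙ-≐ mF ((λ {ω} f → empty (F⊆A f)) , λ ())) ℙ-∅
          where
          empty : ∀ {ω} → ω ∈ A → ⊥
          empty (e , h) with 1+rest≤ (m≤0 e) h
          ... | ()
      onA (suc k) m≤1+k = ≤-resp refl (sym (fromℕ-suc-* k (ℙ A))) (+-monoʳ-≤ (ℙ A)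
        (∑-ℙ≤multiplicity (H ∘ suc) (mH ∘ suc) k mA λ { (e , h) → ℕ.s≤s⁻¹ (1+rest≤ (m≤1+k e) h) }))

    module _ {X : Ω → ℕ} (measurable-X : ∀ k → Measurable (λ ω → X ω ≡ k)) where

      Below : ℕ → Pred Ω 0ℓ
      Below N ω = X ω ℕ.< N

      below-suc : ∀ N → (Below N ∪ (λ ω → X ω ≡ N)) ≐ Below (suc N)
      below-suc N = (λ { (inj₁ X<N) → ℕ.m≤n⇒m≤1+n X<N ; (inj₂ X≡N) → ℕ.s≤s (ℕ.≤-reflexive X≡N) }) ,
        λ { (ℕ.s≤s X≤N) → ℕ.m≤n⇒m<n∨m≡n X≤N }

      measurable-Below : ∀ N → Measurable (Below N)
      measurable-Below zero    = measurable-≐ ((λ ()) , λ ()) measurable-∅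
      measurable-Below (suc N) =
          measurable-≐ (below-suc N) (measurable-∪ (measurable-Below N) (measurable-X N))

      ℙ-Below-suc : ∀ N {H} → Measurable H →
        ℙ (Below (suc N) ∩ H) ≈ ℙ (Below N ∩ H) + ℙ ((λ ω → X ω ≡ N) ∩ H)
      ℙ-Below-suc N {H} mH = trans
        (sym (ℙ-≐ (measurable-∪ mB mN)
          ( (λ { (inj₁ (x , h)) → proj₁ (below-suc N) (inj₁ x) , h
               ; (inj₂ (x , h)) → proj₁ (below-suc N) (inj₂ x) , h })
          , λ { (x , h) → distribute (proj₂ (below-suc N) x) h })))
        (ℙ-∪ mB mN λ { (X<N , _) (X≡N , _) → ℕ.<⇒≢ X<N X≡N })
        where
        mB = measurable-∩ (measurable-Below N) mH
        mN = measurable-∩ (measurable-X N) mH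
        distribute : ∀ {P Q R : Set} → P ⊎ Q → R → (P × R) ⊎ (Q × R)
        distribute (inj₁ p) r = inj₁ (p , r)
        distribute (inj₂ q) r = inj₂ (q , r)

      ℙ-Below : ∀ N → ℙ (Below N) ≈ ∑[ k < N ] ℙ (λ ω → X ω ≡ toℕ k)
      ℙ-Below zero = trans (ℙ-≐ (measurable-Below 0) ((λ ()) , λ ())) ℙ-∅
      ℙ-Below (suc N) = trans
        (ℙ-≐ (measurable-Below (suc N)) ((λ x → x , _) , proj₁))
        (trans (ℙ-Below-suc N measurable-U) (trans
          (+-cong (trans (ℙ-≐ (measurable-∩ (measurable-Below N) measurable-U)
            (proj₁ , λ x → x , _)) (ℙ-Below N))
            (ℙ-≐ (measurable-∩ (measurable-X N) measurable-U) (proj₁ , λ x → x , _)))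
          (sym (∑-snoc (λ k → ℙ (λ ω → X ω ≡ k)) N))))

      -- On the level set where `X` equals `k` at most `k` of the events hold, so each level
      -- contributes at most its term of the mean.
      ∑-ℙ≤truncatedMean : ∀ {n} (H : Fin n → Pred Ω 0ℓ) → (∀ i → Measurable (H i)) →
        (∀ ω → ℕsum (λ i → 𝟙 (em {P = H i ω})) ℕ.≤ X ω) → ∀ N →
        ∑[ i < n ] ℙ (Below N ∩ H i) ≤ ∑[ k < N ] (fromℕ (toℕ k) * ℙ (λ ω → X ω ≡ toℕ k))
      ∑-ℙ≤truncatedMean {n} H mH count zero = ≤-reflexive (trans
        (sum-cong-≋ {n} λ i → trans
          (ℙ-≐ (measurable-∩ (measurable-Below 0) (mH i)) ((λ ()) , λ ())) ℙ-∅)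
        (sum-replicate-zero n))
      ∑-ℙ≤truncatedMean {n} H mH count (suc N) = begin
        ∑[ i < n ] ℙ (Below (suc N) ∩ H i)
          ≈⟨ sum-cong-≋ {n} (λ i → ℙ-Below-suc N (mH i)) ⟩
        ∑[ i < n ] (ℙ (Below N ∩ H i) + ℙ ((λ ω → X ω ≡ N) ∩ H i))
          ≈⟨ ∑-distrib-+ {n} (λ i → ℙ (Below N ∩ H i)) (λ i → ℙ ((λ ω → X ω ≡ N) ∩ H i)) ⟩
        ∑[ i < n ] ℙ (Below N ∩ H i) + ∑[ i < n ] ℙ ((λ ω → X ω ≡ N) ∩ H i)
          ≤⟨ +-mono-≤ (∑-ℙ≤truncatedMean H mH count N)
               (∑-ℙ≤multiplicity H mH N (measurable-X N) λ {ω} X≡N →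
                 ≡.subst (_ ℕ.≤_) X≡N (count ω)) ⟩
        ∑[ k < N ] (fromℕ (toℕ k) * ℙ (λ ω → X ω ≡ toℕ k)) + fromℕ N * ℙ (λ ω → X ω ≡ N)
          ≈⟨ sym (∑-snoc (λ k → fromℕ k * ℙ (λ ω → X ω ≡ k)) N) ⟩
        ∑[ k < suc N ] (fromℕ (toℕ k) * ℙ (λ ω → X ω ≡ toℕ k)) ∎

  -- Likely events and a lower bound for means.

  module Concentration (space : ProbabilitySpace) where
    open ProbabilitySpace space
    open Events space

    -- Free of division and complements; in this form failure percentages add up under intersection.
    FailsAtMost% : ℕ → Pred Ω 0ℓ → Set
    FailsAtMost% a E = Measurable E × fromℕ 100 ≤ fromℕ a + fromℕ 100 * ℙ E

    atLeast99%⇒failsAtMost1% : ∀ {E} → ProbabilityAtLeast-99% E → FailsAtMost% 1 E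
    atLeast99%⇒failsAtMost1% (mE , 99≤) = mE , +-mono-≤ (≤-reflexive (sym (+-identityʳ 1#))) 99≤

    failsAtMost-∩ : ∀ {a b E F} → FailsAtMost% a E → FailsAtMost% b F →
        FailsAtMost% (a ℕ.+ b) (E ∩ F)
    failsAtMost-∩ {a} {b} {E} {F} (mE , E≥) (mF , F≥) = measurable-∩ mE mF , +-cancelˡ-≤ c (begin
      c + c                                       ≤⟨ +-mono-≤ E≥ F≥ ⟩
      fromℕ a + c * ℙ E + (fromℕ b + c * ℙ F)
        ≈⟨ +-interchange (fromℕ a) (c * ℙ E) (fromℕ b) (c * ℙ F) ⟩
      fromℕ a + fromℕ b + (c * ℙ E + c * ℙ F)
        ≈⟨ +-cong (sym (fromℕ-+ a b)) (sym (distribˡ c (ℙ E) (ℙ F))) ⟩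
      fromℕ (a ℕ.+ b) + c * (ℙ E + ℙ F)
        ≤⟨ +-monoʳ-≤ _ (*-monoˡ-≤ (0≤fromℕ 100) (ℙ-∩-lower mE mF)) ⟩
      fromℕ (a ℕ.+ b) + c * (1# + ℙ (E ∩ F))
        ≈⟨ +-congˡ (trans (distribˡ c 1# (ℙ (E ∩ F))) (+-congʳ (*-identityʳ c))) ⟩
      fromℕ (a ℕ.+ b) + (c + c * ℙ (E ∩ F))
        ≈⟨ x+[y+z]≈y+[x+z] (fromℕ (a ℕ.+ b)) c (c * ℙ (E ∩ F)) ⟩
      c + (fromℕ (a ℕ.+ b) + c * ℙ (E ∩ F))       ∎)
      where c = fromℕ 100

    failsAtMost3%⇒1≤100*ℙ : ∀ {E} → FailsAtMost% 3 E → 1# ≤ fromℕ 100 * ℙ E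
    failsAtMost3%⇒1≤100*ℙ {E} (_ , E≥) = +-cancelˡ-≤ (fromℕ 3) (begin
      fromℕ 3 + 1#               ≈⟨ +-congˡ (sym (+-identityʳ 1#)) ⟩
      fromℕ 3 + fromℕ 1          ≈⟨ sym (fromℕ-+ 3 1) ⟩
      fromℕ 4                    ≤⟨ fromℕ-mono {4} {100} (ℕ.≤ᵇ⇒≤ 4 100 _) ⟩
      fromℕ 100                  ≤⟨ E≥ ⟩
      fromℕ 3 + fromℕ 100 * ℙ E  ∎)

    -- The levels of `X` cover the space. If every truncation had probability at most 0.99,
    -- countable additivity would bound the whole space by 0.99.
    below-failsAtMost1% : ∀ {X : Ω → ℕ} (mX : ∀ k → Measurable (λ ω → X ω ≡ k)) → ∃ λ N →
        FailsAtMost% 1 (Below mX N)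
    below-failsAtMost1% {X} mX with em {P = ∃ λ N → FailsAtMost% 1 (Below mX N)}
    ... | yes p = p
    ... | no ¬p = contradiction (fromℕ-cancel {100} {99} 100≤99) (ℕ.<⇒≱ (ℕ.n<1+n 99))
      where
      levels : ℕ → Pred Ω 0ℓ
      levels k ω = X ω ≡ k
      r = proj₁ (positive-reciprocal 100)
      0≤r = proj₁ (proj₁ (proj₂ (positive-reciprocal 100)))
      r*100≈1 = proj₂ (proj₂ (positive-reciprocal 100))
      small : ∀ N → fromℕ 100 * ℙ (Below mX N) ≤ fromℕ 99
      small N with total (fromℕ 100) (fromℕ 1 + fromℕ 100 * ℙ (Below mX N))
      ... | inj₁ large = ⊥-elim (¬p (N , measurable-Below mX N , large))
      ... | inj₂ h     = +-cancelˡ-≤ (fromℕ 1) (≤-resp refl (+-congʳ (sym (+-identityʳ 1#))) h)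
      scale : ∀ x → r * (fromℕ 100 * x) ≈ x
      scale x = trans (sym (*-assoc r (fromℕ 100) x)) (trans (*-congʳ r*100≈1) (*-identityˡ x))
      ℙU≤ : ℙ U ≤ r * fromℕ 99
      ℙU≤ = ≤-resp (ℙ-≐ (measurable-⋃ levels mX) ((λ _ → _) , λ {ω} _ → X ω , ≡.refl)) refl
        (proj₂ (ℙ-⋃ levels mX λ { ≡.refl ≡.refl → ≡.refl }) _ λ { s (N , s≈) →
          ≤-resp (trans (scale _) (trans (ℙ-Below mX N) (sym s≈))) refl (*-monoˡ-≤ 0≤r (small N)) })
      100≤99 : fromℕ 100 ≤ fromℕ 99
      100≤99 = begin
        fromℕ 100                     ≈⟨ sym (*-identityʳ (fromℕ 100)) ⟩
        fromℕ 100 * 1#                ≤⟨ *-monoˡ-≤ (0≤fromℕ 100) (≤-resp ℙ-U refl ℙU≤) ⟩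
        fromℕ 100 * (r * fromℕ 99)    ≈⟨ x*[y*z]≈y*[x*z] (fromℕ 100) r (fromℕ 99) ⟩
        r * (fromℕ 100 * fromℕ 99)    ≈⟨ scale (fromℕ 99) ⟩
        fromℕ 99                      ∎

    -- Truncation costs one more percent, so each event still has probability at least 0.97 below
    -- level `N`. The cruder 1/100 is used, and the factor is absorbed by `K`.
    n≤100*mean : ∀ {n μ} {X : Ω → ℕ} (H : Fin n → Pred Ω 0ℓ) → (∀ i → FailsAtMost% 2 (H i)) →
      (∀ ω → ℕsum (λ i → 𝟙 (em {P = H i ω})) ℕ.≤ X ω) → HasMean X μ → fromℕ n ≤ fromℕ 100 * μ
    n≤100*mean {n} {μ} {X} H likely count (mX , lub) with below-failsAtMost1% mX
    ... | N , below = begin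
      fromℕ n                                         ≈⟨ sym (sum-const-1 n) ⟩
      ∑[ i < n ] 1#
        ≤⟨ sum-mono-≤ {n} _ _ (λ i →
          failsAtMost3%⇒1≤100*ℙ (failsAtMost-∩ {1} {2} below (likely i))) ⟩
      ∑[ i < n ] (fromℕ 100 * ℙ (Below mX N ∩ H i))
        ≈⟨ sym (*-distribˡ-sum {n} (fromℕ 100) (λ i → ℙ (Below mX N ∩ H i))) ⟩
      fromℕ 100 * ∑[ i < n ] ℙ (Below mX N ∩ H i)
        ≤⟨ *-monoˡ-≤ (0≤fromℕ 100)
          (≤-trans (∑-ℙ≤truncatedMean mX H (proj₁ ∘ likely) count N) (proj₁ lub _ (N , refl))) ⟩
      fromℕ 100 * μ                                   ∎

  -- Transcripts of adaptive algorithms, and the supremum norm.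

  queries : ∀ {n d} → QueryAlgorithm n d → Vector Carrier n → List (Fin n)
  queries (output x)  b = []
  queries (query i k) b = i ∷ queries (k (b i)) b

  length-queries : ∀ {n d} (alg : QueryAlgorithm n d) b → length (queries alg b) ≡ queryCount alg b
  length-queries (output x)  b = ≡.refl
  length-queries (query i k) b = ≡.cong suc (length-queries (k (b i)) b)

  -- Despite adaptivity, the two runs stay at the same node as long as the answers agree, so only
  -- entries read on `b` matter.
  result-unqueried : ∀ {n d} (alg : QueryAlgorithm n d) {b b′ : Vector Carrier n} →
    (∀ {i} → i ∈ₗ queries alg b → b i ≡ b′ i) → result alg b ≡ result alg b′
  result-unqueried (output x)  agree = ≡.refl
  result-unqueried (query i k) {b} {b′} agree = ≡.trans (result-unqueried (k (b i)) (agree ∘ there))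
    (≡.cong (λ y → result (k y) b′) (agree (here ≡.refl)))

  x≤∣x∣ : ∀ x → x ≤ ∣ x ∣
  x≤∣x∣ x = x≤x⊔y x (- x)

  -x≤∣x∣ : ∀ x → - x ≤ ∣ x ∣
  -x≤∣x∣ x = x≤y⊔x x (- x)

  ∣entry∣≤‖‖∞ : ∀ {n} (v : Vector Carrier n) i → ∣ v i ∣ ≤ ‖ v ‖∞
  ∣entry∣≤‖‖∞ v zero    = x≤x⊔y _ _
  ∣entry∣≤‖‖∞ v (suc i) = ≤-trans (∣entry∣≤‖‖∞ (v ∘ suc) i) (x≤y⊔x _ _)

  ‖‖∞-lub : ∀ {n} (v : Vector Carrier n) {u} → 0# ≤ u → (∀ i → v i ≤ u × - v i ≤ u) → ‖ v ‖∞ ≤ u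
  ‖‖∞-lub {zero}  v 0≤u v≤u = 0≤u
  ‖‖∞-lub {suc n} v 0≤u v≤u =
      ⊔-lub (⊔-lub (proj₁ (v≤u zero)) (proj₂ (v≤u zero))) (‖‖∞-lub (v ∘ suc) 0≤u (v≤u ∘ suc))

  sum-fromℕ : ∀ {n} (v : Fin n → ℕ) → sum (λ i → fromℕ (v i)) ≈ fromℕ (ℕsum v)
  sum-fromℕ {zero}  v = refl
  sum-fromℕ {suc n} v = trans (+-congˡ (sum-fromℕ (v ∘ suc))) (sym (fromℕ-+ (v zero) _))

  x-0≈x : ∀ x → x - 0# ≈ x
  x-0≈x x = trans (+-congˡ -0#≈0#) (+-identityʳ x)

  spike : ∀ {n} → Fin n → Carrier → Vector Carrier n
  spike i h j with j Fin.≟ i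
  ... | yes _ = h
  ... | no  _ = 0#

  spike-≡ : ∀ {n} (i : Fin n) h → spike i h i ≡ h
  spike-≡ i h with i Fin.≟ i
  ... | yes _  = ≡.refl
  ... | no i≢i = contradiction ≡.refl i≢i

  spike-≢ : ∀ {n} {i j : Fin n} h → j ≢ i → spike i h j ≡ 0#
  spike-≢ {i = i} {j} h j≢i with j Fin.≟ i
  ... | yes j≡i = contradiction j≡i j≢i
  ... | no _    = ≡.refl

  -- The hard regression instances.

  module _ {p} (prime[p] : Prime p) (k : ℕ) {d} (p*p≤d : p ℕ.* p ℕ.≤ d) where

    graphs : Matrix (p ℕ.^ k) d
    graphs f c = fromℕ (row prime[p] k p*p≤d f c)

    graphs*row : ∀ f g → (graphs *ᵥ graphs g) f ≈ fromℕ (agreements prime[p] k p*p≤d f g)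
    graphs*row f g = begin-equality
      ∑[ c < d ] (fromℕ (row′ f c) * fromℕ (row′ g c))
        ≈⟨ sum-cong-≋ {d} (λ c → sym (fromℕ-* (row′ f c) (row′ g c))) ⟩
      ∑[ c < d ] fromℕ (row′ f c ℕ.* row′ g c)
        ≈⟨ sum-fromℕ {d} (λ c → row′ f c ℕ.* row′ g c) ⟩
      fromℕ (ℕsum {d} (λ c → row′ f c ℕ.* row′ g c))
        ≈⟨ reflexive (≡.cong fromℕ (row·row prime[p] k p*p≤d f g)) ⟩
      fromℕ (agreements prime[p] k p*p≤d f g) ∎
      where row′ = row prime[p] k p*p≤d

    residual-zero : residual graphs (λ _ → 0#) (λ _ → 0#) ≤ 0#
    residual-zero = ‖‖∞-lub _ ≤-refl λ f →
        ≤-reflexive (vanishes f) , ≤-reflexive (trans (-‿cong (vanishes f)) -0#≈0#)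
      where
      vanishes : ∀ f → (graphs *ᵥ (λ _ → 0#)) f - 0# ≈ 0#
      vanishes f = trans (x-0≈x _)
          (trans (sum-cong-≋ {d} λ c → zeroʳ (graphs f c)) (sum-replicate-zero d))

    residual-spike : ∀ f → residual graphs (spike f (fromℕ p)) (graphs f) ≤ fromℕ k
    residual-spike f = ‖‖∞-lub _ (0≤fromℕ k) entry
      where
      entry : ∀ g → let r = (graphs *ᵥ graphs f) g - spike f (fromℕ p) g in
        r ≤ fromℕ k × - r ≤ fromℕ k
      entry g with g Fin.≟ f
      ... | yes ≡.refl = ≤-resp (sym r≈0) refl (0≤fromℕ k) ,
          ≤-resp (sym (trans (-‿cong r≈0) -0#≈0#)) refl (0≤fromℕ k)
        where
        r≈0 : (graphs *ᵥ graphs f) f - fromℕ p ≈ 0#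
        r≈0 = trans (+-congʳ (trans (graphs*row f f)
            (reflexive (≡.cong fromℕ (agreements-refl prime[p] k p*p≤d f))))) (-‿inverseʳ (fromℕ p))
      ... | no g≢f = ≤-resp (sym r≈) refl (fromℕ-mono (agreements-≢ prime[p] k p*p≤d g≢f)) ,
          ≤-trans (≤-resp (trans (+-identityˡ _) (-‿cong (sym r≈))) refl
            (x≤y⇒0-y≤0 (0≤fromℕ a))) (0≤fromℕ k)
        where
        a = agreements prime[p] k p*p≤d g f
        r≈ : (graphs *ᵥ graphs f) g - 0# ≈ fromℕ a
        r≈ = trans (x-0≈x _) (graphs*row g f)
        x≤y⇒0-y≤0 : ∀ {y} → 0# ≤ y → 0# - y ≤ 0#
        x≤y⇒0-y≤0 {y} 0≤y = ≤-resp refl (-‿inverseʳ y) (+-monoˡ-≤ (- y) 0≤y)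

    -- An approximate solution for b = 0 is exact, so it has residual at least p for the spike.
    commonSolution⇒p≤κk : ∀ {κ f x} → 0# ≤ κ → ApproxSolution κ graphs (λ _ → 0#) x →
      ApproxSolution κ graphs (spike f (fromℕ p)) x → fromℕ p ≤ κ * fromℕ k
    commonSolution⇒p≤κk {κ} {f} {x} 0≤κ (x₀ , min₀ , approx₀) (x₁ , min₁ , approx₁) = begin
      fromℕ p                        ≈⟨ sym (x+[y-x]≈y y (fromℕ p)) ⟩
      y + (fromℕ p - y)              ≤⟨ +-mono-≤ y≤0 p-y≤ ⟩
      0# + κ * fromℕ k               ≈⟨ +-identityˡ _ ⟩
      κ * fromℕ k                    ∎
      where
      y = (graphs *ᵥ x) f
      y≤0 : y ≤ 0#
      y≤0 = begin
        y                                         ≈⟨ sym (x-0≈x y) ⟩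
        y - 0#                                    ≤⟨ x≤∣x∣ _ ⟩
        ∣ y - 0# ∣                                ≤⟨ ∣entry∣≤‖‖∞ _ f ⟩
        residual graphs (λ _ → 0#) x              ≤⟨ approx₀ ⟩
        κ * residual graphs (λ _ → 0#) x₀
          ≤⟨ *-monoˡ-≤ 0≤κ (≤-trans (min₀ (λ _ → 0#)) residual-zero) ⟩
        κ * 0#                                    ≈⟨ zeroʳ κ ⟩
        0#                                        ∎
      p-y≤ : fromℕ p - y ≤ κ * fromℕ k
      p-y≤ = begin
        fromℕ p - y                               ≈⟨ sym (⁻¹-anti-homo‿- y (fromℕ p)) ⟩
        - (y - fromℕ p)
          ≈⟨ -‿cong (+-congˡ (-‿cong (reflexive (≡.sym (spike-≡ f (fromℕ p)))))) ⟩
        - (y - b f)                               ≤⟨ -x≤∣x∣ _ ⟩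
        ∣ y - b f ∣                               ≤⟨ ∣entry∣≤‖‖∞ (λ i → (graphs *ᵥ x) i - b i) f ⟩
        residual graphs b x                       ≤⟨ approx₁ ⟩
        κ * residual graphs b x₁
          ≤⟨ *-monoˡ-≤ 0≤κ (≤-trans (min₁ (graphs f)) (residual-spike f)) ⟩
        κ * fromℕ k                               ∎
        where b = spike f (fromℕ p)

  -- Upper bounds for square roots and real powers.

  0≤√ : ∀ d → 0# ≤ √ d
  0≤√ d = proj₁ (√-isLUB d) 0# (≤-resp (sym (zeroˡ 0#)) refl (0≤fromℕ d))

  √≤ : ∀ {d} m .{{_ : NonZero m}} → d ℕ.≤ m ℕ.* m → √ d ≤ fromℕ m
  √≤ {d} m d≤m² = proj₂ (√-isLUB d) (fromℕ m) λ y y²≤d → ^-cancel (1≤fromℕ m) 1 (begin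
    y * (y * 1#)                 ≈⟨ *-congˡ (*-identityʳ y) ⟩
    y * y                        ≤⟨ y²≤d ⟩
    fromℕ d                      ≤⟨ fromℕ-mono d≤m² ⟩
    fromℕ (m ℕ.* m)              ≈⟨ trans (fromℕ-* m m) (*-congˡ (sym (*-identityʳ (fromℕ m)))) ⟩
    fromℕ m * (fromℕ m * 1#)     ∎)

  rpow≤ : ∀ d .{{_ : NonZero d}} {C} (0≤C : 0# ≤ C) k → C ≤ fromℕ k → rpow d C 0≤C ≤ fromℕ (d ℕ.^ k)
  rpow≤ d {C} 0≤C k C≤k = ≤-resp refl (sym (fromℕ-^ d k)) (proj₂ (rpow-isLUB d C 0≤C) (fromℕ d ^ k)
    λ { y (a , q , a≤Cq , y^q≤d^a) → ^-cancel (1≤x^n (1≤fromℕ d) k) q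
      (≤-trans y^q≤d^a (≤-resp refl (sym (^-assocʳ (fromℕ d) k (suc q)))
        (^-monoʳ (1≤fromℕ d) (fromℕ-cancel {a} {k ℕ.* suc q}
          (≤-trans a≤Cq (≤-resp refl (sym (fromℕ-* k (suc q)))
            (*-monoʳ-≤ (0≤fromℕ (suc q)) C≤k))))))) })

  -- Every entry is likely to be read.

  module _ {p} (prime[p] : Prime p) (k : ℕ) {d} (p*p≤d : p ℕ.* p ℕ.≤ d) where

    private
      A = graphs prime[p] k p*p≤d

    -- The answers for b = 0 and for the spike at f differ only at f, so an algorithm that
    -- succeeds on both must read the entry f of b = 0.
    n≤100*m : ∀ {κ m} → 0# ≤ κ → ¬ fromℕ p ≤ κ * fromℕ k → (alg : RegressionAlgorithm d) →
      SolvesUpTo κ alg → WorstCaseQueries alg (p ℕ.^ k) m → fromℕ (p ℕ.^ k) ≤ fromℕ 100 * m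
    n≤100*m {κ} {m} 0≤κ κk<p alg solves (means , lub) = ≤-trans
      (n≤100*mean succeedsOnBoth
        (λ f → failsAtMost-∩ {1} {1} (atLeast99%⇒failsAtMost1% (solves A zeros))
          (atLeast99%⇒failsAtMost1% (solves A (spikeAt f))))
        (λ ω → ℕ.≤-trans (∑𝟙≤length (λ f → em) (queries (choose ω) zeros) (queried ω))
          (ℕ.≤-reflexive (length-queries (choose ω) zeros)))
        (proj₂ mean))
      (*-monoˡ-≤ (0≤fromℕ 100) (proj₁ lub _ (A , zeros , proj₂ mean)))
      where
      open RandomizedQueryAlgorithm (alg A)
      open Concentration space
      zeros : Vector Carrier (p ℕ.^ k)
      zeros _ = 0#
      spikeAt : Fin (p ℕ.^ k) → Vector Carrier (p ℕ.^ k)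
      spikeAt f = spike f (fromℕ p)
      mean = means A zeros
      Succeeds : Vector Carrier (p ℕ.^ k) → Pred Ω 0ℓ
      Succeeds b ω = ApproxSolution κ A b (result (choose ω) b)
      -- The event that `f` is read is not known to be measurable. Success on both inputs is
      -- measurable by `SolvesUpTo`, has probability at least 0.98, and implies that `f` is read.
      succeedsOnBoth : Fin (p ℕ.^ k) → Pred Ω 0ℓ
      succeedsOnBoth f = Succeeds zeros ∩ Succeeds (spikeAt f)
      queried : ∀ ω f → ω ∈ succeedsOnBoth f → f ∈ₗ queries (choose ω) zeros
      queried ω f (zeros✓ , spike✓) with any? (f Fin.≟_) (queries (choose ω) zeros)
      ... | yes f∈ = f∈
      ... | no  f∉ = contradiction
        (commonSolution⇒p≤κk prime[p] k p*p≤d 0≤κ zeros✓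
          (≡.subst (ApproxSolution κ A (spikeAt f))
            (≡.sym (result-unqueried (choose ω) {zeros} {spikeAt f}
              λ {g} g∈ → ≡.sym (spike-≢ {i = f} {g} (fromℕ p) λ { ≡.refl → f∉ g∈ })))
            spike✓))
        κk<p

theorem14p4 : (em : ExcludedMiddle 0ℓ) (ℝ : CompleteOrderedField) →
    let open RealAnalysis em ℝ in
    ∀ (C : Carrier) (1<C : 1# < C) →
    ∃ λ (c : Carrier) → 0# < c ×
    ∃ λ (K : Carrier) → 0# < K ×
    ∃ λ (d₀ : ℕ) → ∃ λ (n : ℕ → ℕ) →
    ∀ (d : ℕ) .{{_ : NonZero d}} → d₀ ℕ.≤ d →
    ∀ (alg : RegressionAlgorithm d) → SolvesUpTo (c * √ d) alg →
    ∀ (m : Carrier) → WorstCaseQueries alg (n d) m →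
    K * rpow d C (1<x⇒0≤x 1<C) ≤ m
theorem14p4 em ℝ C 1<C =
  c , 0<c , K , 0<K , 16 ℕ.^ 11 , (λ d → primeNear d ℕ.^ k) , bound
  where
  open LowerBound em ℝ
  open PrimeNearSquareRoot using (primeNear√; power≤)
  open import Data.Nat.Primality using (prime⇒nonZero)
  import Data.Nat.Properties as ℕ
  open import Data.Nat.Tactic.RingSolver using (solve-∀)
  open import Data.Product.Base using (_,_; proj₁; proj₂)
  open import Relation.Binary.PropositionalEquality as ≡ using (_≡_)
  open import Relation.Binary.Reasoning.PartialOrder poset
  open import Relation.Nullary.Negation.Core using (¬_)
  -- `k₀` bounds `C`, and the successor keeps `k` positive for the reciprocal of `128 k`. Doubling
  -- compensates for `p` being of order √d only: `p ^ k` is of order `d ^ k₀`.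
  k₀ = ℕ.suc (proj₁ (archimedean C))
  k = k₀ ℕ.+ k₀
  D = 64 ℕ.^ k
  primeNear = λ d → proj₁ (primeNear√ d)
  instance
    D*100≢0 : NonZero (D ℕ.* 100)
    D*100≢0 = ℕ.m*n≢0 D 100 {{ℕ.m^n≢0 64 k}}
  -- Since √d ≤ 64 p and d ^ k₀ ≤ 64 ^ k * p ^ k, the choices c = 1 / (128 k) and
  -- K = 1 / (100 * 64 ^ k) give c √d k ≤ p / 2 and K d ^ k₀ ≤ p ^ k / 100 ≤ m.
  c-spec = positive-reciprocal (128 ℕ.* k)
  K-spec = positive-reciprocal (D ℕ.* 100)
  c = proj₁ c-spec
  K = proj₁ K-spec
  0<c = proj₁ (proj₂ c-spec)
  0<K = proj₁ (proj₂ K-spec)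
  bound : ∀ (d : ℕ) .{{_ : NonZero d}} → 16 ℕ.^ 11 ℕ.≤ d →
    ∀ (alg : RegressionAlgorithm d) → SolvesUpTo (c * √ d) alg →
    ∀ (m : Carrier) → WorstCaseQueries alg (primeNear d ℕ.^ k) m →
    K * rpow d C (1<x⇒0≤x 1<C) ≤ m
  bound d large alg solves m worst with proj₂ (primeNear√ d) large
  ... | prime[p] , p*p≤d , d≤[64p]² = begin
    K * rpow d C (1<x⇒0≤x 1<C)
      ≤⟨ *-monoˡ-≤ (proj₁ 0<K) (rpow≤ d (1<x⇒0≤x 1<C) k₀
        (≤-trans (proj₂ (archimedean C)) (fromℕ-mono (ℕ.n≤1+n (proj₁ (archimedean C)))))) ⟩
    K * fromℕ (d ℕ.^ k₀)
      ≤⟨ *-monoˡ-≤ (proj₁ 0<K) (fromℕ-mono (power≤ 64 p k₀ d≤[64p]²)) ⟩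
    K * fromℕ (D ℕ.* p ℕ.^ k)
      ≈⟨ *-congˡ (fromℕ-* D (p ℕ.^ k)) ⟩
    K * (fromℕ D * fromℕ (p ℕ.^ k))
      ≤⟨ *-monoˡ-≤ (proj₁ 0<K) (*-monoˡ-≤ (0≤fromℕ D)
           (n≤100*m prime[p] k p*p≤d (*-nonNeg (proj₁ 0<c) (0≤√ d)) κk<p alg solves worst)) ⟩
    K * (fromℕ D * (fromℕ 100 * m))
      ≈⟨ *-congˡ (trans (sym (*-assoc (fromℕ D) (fromℕ 100) m)) (*-congʳ (sym (fromℕ-* D 100)))) ⟩
    K * (fromℕ (D ℕ.* 100) * m)
      ≈⟨ trans (sym (*-assoc K _ m)) (trans (*-congʳ (proj₂ (proj₂ K-spec))) (*-identityˡ m)) ⟩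
    m ∎
    where
    p = primeNear d
    instance
      p≢0 : NonZero p
      p≢0 = prime⇒nonZero prime[p]
      64p≢0 : NonZero (64 ℕ.* p)
      64p≢0 = ℕ.m*n≢0 64 p
      64pk≢0 : NonZero (64 ℕ.* p ℕ.* k)
      64pk≢0 = ℕ.m*n≢0 (64 ℕ.* p) k
    κk<p : ¬ fromℕ p ≤ c * √ d * fromℕ k
    -- Multiplied by `128 k`, the inequality would become `2 N ≤ N` for the positive `N = 64 p k`.
    κk<p p≤κk = ℕ.<⇒≱ (ℕ.m<m+n N (ℕ.>-nonZero⁻¹ N)) (fromℕ-cancel {N ℕ.+ N} {N} (begin
      fromℕ (N ℕ.+ N)
        ≈⟨ reflexive (≡.cong fromℕ (double p k)) ⟩
      fromℕ (128 ℕ.* k ℕ.* p)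
        ≈⟨ fromℕ-* (128 ℕ.* k) p ⟩
      fromℕ (128 ℕ.* k) * fromℕ p
        ≤⟨ *-monoˡ-≤ (0≤fromℕ (128 ℕ.* k)) p≤κk ⟩
      fromℕ (128 ℕ.* k) * (c * √ d * fromℕ k)
        ≤⟨ *-monoˡ-≤ (0≤fromℕ (128 ℕ.* k))
          (*-monoʳ-≤ (0≤fromℕ k) (*-monoˡ-≤ (proj₁ 0<c) (√≤ (64 ℕ.* p) d≤[64p]²))) ⟩
      fromℕ (128 ℕ.* k) * (c * fromℕ (64 ℕ.* p) * fromℕ k)
        ≈⟨ *-congˡ (trans (*-assoc c _ _) (*-congˡ (sym (fromℕ-* (64 ℕ.* p) k)))) ⟩
      fromℕ (128 ℕ.* k) * (c * fromℕ N)
        ≈⟨ trans (x*[y*z]≈y*[x*z] _ c (fromℕ N)) (sym (*-assoc c _ (fromℕ N))) ⟩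
      c * fromℕ (128 ℕ.* k) * fromℕ N
        ≈⟨ trans (*-congʳ (proj₂ (proj₂ c-spec))) (*-identityˡ (fromℕ N)) ⟩
      fromℕ N ∎))
      where
      N = 64 ℕ.* p ℕ.* k
      double : ∀ p k → 64 ℕ.* p ℕ.* k ℕ.+ 64 ℕ.* p ℕ.* k ≡ 128 ℕ.* k ℕ.* p
      double = solve-∀
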